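{- For any normalised eliminator $e:\Gamma\multimap_e\Delta$ (with $\Theta,\Delta,\Xi\vdash t:A$, so that $\Theta,\Gamma,\Xi\vdash\mathrm{let}\ e\ \mathrm{in}\ t:A$), we have $[\![\mathrm{let}\ e\ \mathrm{in}\ t:A]\!]=[\![t]\!]$, where $[\![-]\!]$ is the interpretation of the annotated language in a categorical model.
   Context: Fix a set $\mathbf{Q}$ of qubits and a set $\mathbf{G}$ of gates; each gate $G$ comes with a tuple $(q_1,\dots,q_n)$ of distinct qubits and a duration $d\in\mathbb{R}_{\ge0}$; write $(G,d,q_1,\dots,q_n)\in\mathbf{G}$. **Annotated language.** Types: $A,B::=1\mid q\mid A\otimes B\mid \Box_d A$ ($q\in\mathbf{Q}$, $d\in\mathbb{R}$). Contexts: lists of graded declarations $x:^d A$, $d\in\mathbb{R}$. $d+\Gamma$ adds $d$ to every grade of $\Gamma$. Typing rules: - Swap: from $\Gamma,x:^dA,y:^eB,\Delta\vdash t:C$ infer $\Gamma,y:^eB,x:^dA,\Delta\vdash t:C$. - Var: $x:^0A\vdash x:A$. Unit-I: $\vdash *:1$. - Unit-E: from $\Gamma\vdash s:1$, $\Delta\vdash t:A$ infer $d+\Gamma,\Delta\vdash\mathrm{let}\ *=s\ \mathrm{in}\ t:A$. - Gate: for $(G,d,q_1,\dots,q_n)\in\mathbf{G}$, from $\Gamma_i\vdash t_i:q_i$ infer $-d+\Gamma_1,\dots,-d+\Gamma_n\vdash G(t_1,\dots,t_n):q_1\otimes\cdots\otimes q_n$. - Tens-I: from $\Gamma\vdash s:A$,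 $\Delta\vdash t:B$ infer $\Gamma,\Delta\vdash(s,t):A\otimes B$. - Tens-E: from $\Gamma\vdash s:A\otimes B$ and $x:^dA,y:^dB,\Delta\vdash t:C$ infer $d+\Gamma,\Delta\vdash\mathrm{let}\ (x,y)=s\ \mathrm{in}\ t:C$. - Box-I: from $\Gamma\vdash t:A$ infer $d+\Gamma\vdash\mathrm{box}\ d\ t:\Box_dA$. - Box-E: from $\Gamma\vdash s:\Box_dA$ and $x:^eA,\Delta\vdash t:B$ infer $(e-d)+\Gamma,\Delta\vdash\mathrm{let\ box}\ d\ x=s\ \mathrm{in}\ t:B$. - Delay: from $\Gamma\vdash t:q$, $d\ge0$ infer $-d+\Gamma\vdash\mathrm{delay}_d(t):q$. - Let: from $\Gamma\vdash s:A$ and $x:^dA,\Delta\vdash t:C$ infer $d+\Gamma,\Delta\vdash\mathrm{let}\ x=s\ \mathrm{in}\ t:C$. **Normalised eliminators.** The relation $e:\Gamma\multimap_e\Delta$ has the instances - $(*=x):(x:^d1)\multimap_e[]$; - $((x,y)=z):(z:^d(A\otimes B))\multimap_e(x:^dA,\,y:^dB)$; - $(\mathrm{box}\ e'\ x=z):(z:^d\Box_{e'}A)\multimap_e(x:^{d+e'}A)$. For $e:\Gamma\multimap_e\Delta$, from $\Theta,\Delta,\Xi\vdash t:A$ one infers $\Theta,\Gamma,\Xi\vdash\mathrm{let}\ e\ \mathrm{in}\ t:A$ (the corresponding elimination rule applied to a variable, up to Swap). **Categorical model of the annotated language.** This consists of: a symmetric monoidal category $\mathcal{C}^\otimes$ with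 unit $I$; for every $q\in\mathbf{Q}$ an object $X_q$; a monoidal functor $\mathrm{Shift}(-)$ from the discrete category of real numbers (monoidal under $+$) to the category of symmetric monoidal endofunctors of $\mathcal{C}^\otimes$ (so there are coherent natural isomorphisms $\mathrm{Shift}(0)(X)\simeq X$, $\mathrm{Shift}(d_1+d_2)(X)\simeq\mathrm{Shift}(d_1)(\mathrm{Shift}(d_2)(X))$, $\mathrm{Shift}(d)(I)\simeq I$, $\mathrm{Shift}(d)(X\otimes Y)\simeq\mathrm{Shift}(d)(X)\otimes\mathrm{Shift}(d)(Y)$); for every gate $(G,d,q_1,\dots,q_n)$ a morphism $f_G:\mathrm{Shift}(-d)(\bigotimes_iX_{q_i})\to\bigotimes_iX_{q_i}$; for every $x\in\mathbb{R}$ and $q\in\mathbf{Q}$ a morphism $\mathrm{delay}_x:\mathrm{Shift}(-x)(X_q)\to X_q$. **Interpretation.** $[\![1]\!]:=I$, $[\![q]\!]:=X_q$, $[\![A\otimes B]\!]:=[\![A]\!]\otimes[\![B]\!]$, $[\![\Box_dA]\!]:=\mathrm{Shift}(d)[\![A]\!]$; $[\![[]]\!]:=I$, $[\![x:^dA,\Gamma]\!]:=\mathrm{Shift}(d)[\![A]\!]\otimes[\![\Gamma]\!]$, so that $[\![d+\Gamma]\!]\simeq\mathrm{Shift}(d)[\![\Gamma]\!]$. A derivation of $\Gamma\vdash t:A$ is interpreted as a morphism $[\![t]\!]:[\![\Gamma]\!]\to[\![A]\!]$, by induction, with coherence isomorphisms inserted where appropriate: Swap is composition with the symmetry; Var and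 Unit-I are identities; Unit-E is $\mathrm{Shift}(d)[\![s]\!]\otimes[\![t]\!]$; Tens-I is $[\![s]\!]\otimes[\![t]\!]$; Tens-E and Let are $[\![t]\!]\circ(\mathrm{Shift}(d)[\![s]\!]\otimes\mathrm{id})$; Gate is $f_G\circ\mathrm{Shift}(-d)(\bigotimes_i[\![t_i]\!])$; Delay is $\mathrm{delay}_d\circ\mathrm{Shift}(-d)[\![t]\!]$; Box-I is $\mathrm{Shift}(d)[\![t]\!]$; Box-E is $[\![t]\!]\circ(\mathrm{Shift}(e-d)[\![s]\!]\otimes\mathrm{id})$. -}

module Defs where

open import Algebra.Bundles using (AbelianGroup)
open import Algebra.Structures using (IsAbelianGroup)
open import Data.List using (List; []; _∷_; [_]; _++_; map; concat)
open import Data.List.Relation.Binary.Pointwise using (Pointwise; []; _∷_)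
open import Data.List.Relation.Unary.Unique.Propositional using (Unique)
open import Data.Nat as ℕ using (ℕ)
import Data.Nat.Properties as ℕ
open import Data.Product using (∃; _,_)
open import Data.Rational as ℚ using (ℚ; 0ℚ; ½)
import Data.Rational.Properties as ℚ
open import Data.Rational.Solver using (module +-*-Solver)
open import Level using (Level; 0ℓ; _⊔_) renaming (suc to lsuc)
open import Relation.Binary using (IsEquivalence)
open import Relation.Binary.Construct.Closure.ReflexiveTransitive using (Star; _◅_; _◅◅_; gmap) renaming (ε to done)
open import Relation.Binary.PropositionalEquality using (_≡_; refl; sym; subst)

-- The real numbers: Cauchy sequences of rationals.  As quotients are not
-- available, equality of reals is the relation _≈ᴿ_.

infixl 6 _+_ _-_
infix  8 -_
infix  4 _≈ᴿ_ _≤_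

record ℝ : Set where
  no-eta-equality
  field
    seq    : ℕ → ℚ
    cauchy : ∀ ε → 0ℚ ℚ.< ε →
             ∃ λ N → ∀ m n → N ℕ.≤ m → N ℕ.≤ n → ℚ.∣ seq m ℚ.- seq n ∣ ℚ.< ε
open ℝ

record _≈ᴿ_ (x y : ℝ) : Set where
  field
    close : ∀ ε → 0ℚ ℚ.< ε → ∃ λ N → ∀ n → N ℕ.≤ n → ℚ.∣ seq x n ℚ.- seq y n ∣ ℚ.< ε
open _≈ᴿ_

record _≤_ (x y : ℝ) : Set where
  field
    below : ∀ ε → 0ℚ ℚ.< ε → ∃ λ N → ∀ n → N ℕ.≤ n → seq x n ℚ.< seq y n ℚ.+ ε

private
  half : ∀ {ε} → 0ℚ ℚ.< ε → 0ℚ ℚ.< ½ ℚ.* ε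
  half {ε} ε>0 = ℚ.positive⁻¹ (½ ℚ.* ε) {{ℚ.pos*pos⇒pos ½ ε {{ℚ.positive ε>0}}}}

  halves : ∀ ε → ½ ℚ.* ε ℚ.+ ½ ℚ.* ε ≡ ε
  halves = solve 1 (λ ε → con ½ :* ε :+ con ½ :* ε := ε) refl
    where open +-*-Solver

  ∣+∣< : ∀ {ε p q r} → r ≡ p ℚ.+ q → ℚ.∣ p ∣ ℚ.< ½ ℚ.* ε → ℚ.∣ q ∣ ℚ.< ½ ℚ.* ε → ℚ.∣ r ∣ ℚ.< ε
  ∣+∣< {ε} {p} {q} refl p<ε q<ε = subst (ℚ.∣ p ℚ.+ q ∣ ℚ.<_) (halves ε)
    (ℚ.≤-<-trans (ℚ.∣p+q∣≤∣p∣+∣q∣ p q) (ℚ.+-mono-< p<ε q<ε))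

  ∣-∣< : ∀ {ε p r} → r ≡ ℚ.- p → ℚ.∣ p ∣ ℚ.< ε → ℚ.∣ r ∣ ℚ.< ε
  ∣-∣< {ε} {p} refl = subst (ℚ._< ε) (sym (ℚ.∣-p∣≡∣p∣ p))

  ∣0∣< : ∀ {ε p q} → p ≡ q → 0ℚ ℚ.< ε → ℚ.∣ p ℚ.- q ∣ ℚ.< ε
  ∣0∣< {ε} {p} refl = subst (λ z → ℚ.∣ z ∣ ℚ.< ε) (sym (ℚ.+-inverseʳ p))

  chain : ∀ a b c → a ℚ.- c ≡ (a ℚ.- b) ℚ.+ (b ℚ.- c)
  chain = solve 3 (λ a b c → a :- c := (a :- b) :+ (b :- c)) refl
    where open +-*-Solver

  flip- : ∀ a b → b ℚ.- a ≡ ℚ.- (a ℚ.- b)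
  flip- = solve 2 (λ a b → b :- a := :- (a :- b)) refl
    where open +-*-Solver

  neg- : ∀ a b → ℚ.- a ℚ.- ℚ.- b ≡ ℚ.- (a ℚ.- b)
  neg- = solve 2 (λ a b → :- a :- :- b := :- (a :- b)) refl
    where open +-*-Solver

  medial : ∀ a b c d → (a ℚ.+ b) ℚ.- (c ℚ.+ d) ≡ (a ℚ.- c) ℚ.+ (b ℚ.- d)
  medial = solve 4 (λ a b c d → (a :+ b) :- (c :+ d) := (a :- c) :+ (b :- d)) refl
    where open +-*-Solver

0ℝ : ℝ
seq    0ℝ _ = 0ℚ
cauchy 0ℝ ε ε>0 = 0 , λ _ _ _ _ → ∣0∣< {p = 0ℚ} refl ε>0

_+_ : ℝ → ℝ → ℝ
seq    (x + y) n = seq x n ℚ.+ seq y n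
cauchy (x + y) ε ε>0 with cauchy x (½ ℚ.* ε) (half ε>0) | cauchy y (½ ℚ.* ε) (half ε>0)
... | M , p | N , q = M ℕ.⊔ N , λ m n M⊔N≤m M⊔N≤n →
  ∣+∣< (medial (seq x m) (seq y m) (seq x n) (seq y n))
       (p m n (ℕ.m⊔n≤o⇒m≤o M N M⊔N≤m) (ℕ.m⊔n≤o⇒m≤o M N M⊔N≤n))
       (q m n (ℕ.m⊔n≤o⇒n≤o M N M⊔N≤m) (ℕ.m⊔n≤o⇒n≤o M N M⊔N≤n))

-_ : ℝ → ℝ
seq    (- x) n = ℚ.- seq x n
cauchy (- x) ε ε>0 with cauchy x ε ε>0
... | N , p = N , λ m n N≤m N≤n → ∣-∣< (neg- (seq x m) (seq x n)) (p m n N≤m N≤n)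

_-_ : ℝ → ℝ → ℝ
x - y = x + (- y)

private
  pointwise : ∀ {x y} → (∀ n → seq x n ≡ seq y n) → x ≈ᴿ y
  close (pointwise x≡y) ε ε>0 = 0 , λ n _ → ∣0∣< (x≡y n) ε>0

≈ᴿ-isEquivalence : IsEquivalence _≈ᴿ_
IsEquivalence.refl  ≈ᴿ-isEquivalence = pointwise λ _ → refl
close (IsEquivalence.sym ≈ᴿ-isEquivalence {x} {y} x≈y) ε ε>0 with close x≈y ε ε>0
... | N , p = N , λ n N≤n → ∣-∣< (flip- (seq x n) (seq y n)) (p n N≤n)
close (IsEquivalence.trans ≈ᴿ-isEquivalence {x} {y} {z} x≈y y≈z) ε ε>0
  with close x≈y (½ ℚ.* ε) (half ε>0) | close y≈z (½ ℚ.* ε) (half ε>0)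
... | M , p | N , q = M ℕ.⊔ N , λ n M⊔N≤n →
  ∣+∣< (chain (seq x n) (seq y n) (seq z n))
       (p n (ℕ.m⊔n≤o⇒m≤o M N M⊔N≤n)) (q n (ℕ.m⊔n≤o⇒n≤o M N M⊔N≤n))

open IsEquivalence ≈ᴿ-isEquivalence public
  using () renaming (refl to ≈ᴿ-refl; sym to ≈ᴿ-sym; trans to ≈ᴿ-trans)

+-cong : ∀ {x x′ y y′} → x ≈ᴿ x′ → y ≈ᴿ y′ → x + y ≈ᴿ x′ + y′
close (+-cong {x} {x′} {y} {y′} x≈x′ y≈y′) ε ε>0
  with close x≈x′ (½ ℚ.* ε) (half ε>0) | close y≈y′ (½ ℚ.* ε) (half ε>0)
... | M , p | N , q = M ℕ.⊔ N , λ n M⊔N≤n →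
  ∣+∣< (medial (seq x n) (seq y n) (seq x′ n) (seq y′ n))
       (p n (ℕ.m⊔n≤o⇒m≤o M N M⊔N≤n)) (q n (ℕ.m⊔n≤o⇒n≤o M N M⊔N≤n))

-‿cong : ∀ {x y} → x ≈ᴿ y → - x ≈ᴿ - y
close (-‿cong {x} {y} x≈y) ε ε>0 with close x≈y ε ε>0
... | N , p = N , λ n N≤n → ∣-∣< (neg- (seq x n) (seq y n)) (p n N≤n)

+-assoc : ∀ x y z → (x + y) + z ≈ᴿ x + (y + z)
+-assoc x y z = pointwise λ n → ℚ.+-assoc (seq x n) (seq y n) (seq z n)

+-comm : ∀ x y → x + y ≈ᴿ y + x
+-comm x y = pointwise λ n → ℚ.+-comm (seq x n) (seq y n)

+-identityˡ : ∀ x → 0ℝ + x ≈ᴿ x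
+-identityˡ x = pointwise λ n → ℚ.+-identityˡ (seq x n)

+-identityʳ : ∀ x → x + 0ℝ ≈ᴿ x
+-identityʳ x = pointwise λ n → ℚ.+-identityʳ (seq x n)

+-inverseˡ : ∀ x → (- x) + x ≈ᴿ 0ℝ
+-inverseˡ x = pointwise λ n → ℚ.+-inverseˡ (seq x n)

+-inverseʳ : ∀ x → x - x ≈ᴿ 0ℝ
+-inverseʳ x = pointwise λ n → ℚ.+-inverseʳ (seq x n)

+-0-isAbelianGroup : IsAbelianGroup _≈ᴿ_ _+_ 0ℝ (-_)
+-0-isAbelianGroup = record
  { isGroup = record
    { isMonoid = record
      { isSemigroup = record
        { isMagma = record { isEquivalence = ≈ᴿ-isEquivalence ; ∙-cong = +-cong }
        ; assoc = +-assoc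
        }
      ; identity = +-identityˡ , +-identityʳ
      }
    ; inverse = +-inverseˡ , +-inverseʳ
    ; ⁻¹-cong = -‿cong
    }
  ; comm = +-comm
  }

+-0-abelianGroup : AbelianGroup 0ℓ 0ℓ
+-0-abelianGroup = record { isAbelianGroup = +-0-isAbelianGroup }

[x-y]+y≈x : ∀ x y → (x - y) + y ≈ᴿ x
[x-y]+y≈x x y = ≈ᴿ-trans (+-assoc x (- y) y) (≈ᴿ-trans (+-cong ≈ᴿ-refl (+-inverseˡ y)) (+-identityʳ x))

[x+y]-y≈x : ∀ x y → (x + y) - y ≈ᴿ x
[x+y]-y≈x x y = ≈ᴿ-trans (+-assoc x y (- y)) (≈ᴿ-trans (+-cong ≈ᴿ-refl (+-inverseʳ y)) (+-identityʳ x))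

record Category (o ℓ e : Level) : Set (lsuc (o ⊔ ℓ ⊔ e)) where
  infix  4 _⇒_ _≈_ _≅_
  infixr 9 _∘_ _∘ᵢ_
  field
    Obj   : Set o
    _⇒_   : Obj → Obj → Set ℓ
    _≈_   : ∀ {X Y} → X ⇒ Y → X ⇒ Y → Set e
    id    : ∀ {X} → X ⇒ X
    _∘_   : ∀ {X Y Z} → Y ⇒ Z → X ⇒ Y → X ⇒ Z
    equiv     : ∀ {X Y} → IsEquivalence (_≈_ {X} {Y})
    ∘-resp-≈  : ∀ {X Y Z} {f f′ : Y ⇒ Z} {g g′ : X ⇒ Y} → f ≈ f′ → g ≈ g′ → f ∘ g ≈ f′ ∘ g′
    assoc     : ∀ {W X Y Z} {f : Y ⇒ Z} {g : X ⇒ Y} {h : W ⇒ X} → (f ∘ g) ∘ h ≈ f ∘ (g ∘ h)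
    identityˡ : ∀ {X Y} {f : X ⇒ Y} → id ∘ f ≈ f
    identityʳ : ∀ {X Y} {f : X ⇒ Y} → f ∘ id ≈ f

  module Equiv {X Y} = IsEquivalence (equiv {X} {Y})

  record _≅_ (X Y : Obj) : Set (ℓ ⊔ e) where
    field
      from : X ⇒ Y
      to   : Y ⇒ X
      isoˡ : to ∘ from ≈ id
      isoʳ : from ∘ to ≈ id
  open _≅_ public

  private
    cancel : ∀ {X Y Z} {f : Y ⇒ Z} {f⁻¹ : Z ⇒ Y} {g : X ⇒ Y} {g⁻¹ : Y ⇒ X} →
             f⁻¹ ∘ f ≈ id → g⁻¹ ∘ g ≈ id → (g⁻¹ ∘ f⁻¹) ∘ (f ∘ g) ≈ id
    cancel p q = Equiv.trans assoc (Equiv.trans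
      (∘-resp-≈ Equiv.refl (Equiv.trans (Equiv.sym assoc) (Equiv.trans (∘-resp-≈ p Equiv.refl) identityˡ)))
      q)

  idᵢ : ∀ {X} → X ≅ X
  idᵢ = record { from = id ; to = id ; isoˡ = identityˡ ; isoʳ = identityˡ }

  _⁻¹ : ∀ {X Y} → X ≅ Y → Y ≅ X
  i ⁻¹ = record { from = to i ; to = from i ; isoˡ = isoʳ i ; isoʳ = isoˡ i }

  _∘ᵢ_ : ∀ {X Y Z} → Y ≅ Z → X ≅ Y → X ≅ Z
  i ∘ᵢ j = record
    { from = from i ∘ from j
    ; to   = to j ∘ to i
    ; isoˡ = cancel (isoˡ i) (isoˡ j)
    ; isoʳ = cancel (isoʳ j) (isoʳ i)
    }

record SymmetricMonoidalCategory (o ℓ e : Level) : Set (lsuc (o ⊔ ℓ ⊔ e)) where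
  infixr 10 _⊗₀_ _⊗₁_ _⊗ᵢ_
  field
    category : Category o ℓ e
  open Category category public
  field
    I    : Obj
    _⊗₀_ : Obj → Obj → Obj
    _⊗₁_ : ∀ {X X′ Y Y′} → X ⇒ X′ → Y ⇒ Y′ → X ⊗₀ Y ⇒ X′ ⊗₀ Y′

    ⊗-identity     : ∀ {X Y} → id {X} ⊗₁ id {Y} ≈ id
    ⊗-homomorphism : ∀ {X X′ X″ Y Y′ Y″} {f : X ⇒ X′} {f′ : X′ ⇒ X″} {g : Y ⇒ Y′} {g′ : Y′ ⇒ Y″} →
                     (f′ ∘ f) ⊗₁ (g′ ∘ g) ≈ (f′ ⊗₁ g′) ∘ (f ⊗₁ g)
    ⊗-resp-≈       : ∀ {X X′ Y Y′} {f f′ : X ⇒ X′} {g g′ : Y ⇒ Y′} →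
                     f ≈ f′ → g ≈ g′ → f ⊗₁ g ≈ f′ ⊗₁ g′

    unitorˡ    : ∀ {X} → I ⊗₀ X ≅ X
    unitorʳ    : ∀ {X} → X ⊗₀ I ≅ X
    associator : ∀ {X Y Z} → (X ⊗₀ Y) ⊗₀ Z ≅ X ⊗₀ (Y ⊗₀ Z)
    braiding   : ∀ {X Y} → X ⊗₀ Y ⇒ Y ⊗₀ X

    unitorˡ-natural    : ∀ {X Y} {f : X ⇒ Y} → from unitorˡ ∘ (id ⊗₁ f) ≈ f ∘ from unitorˡ
    unitorʳ-natural    : ∀ {X Y} {f : X ⇒ Y} → from unitorʳ ∘ (f ⊗₁ id) ≈ f ∘ from unitorʳ
    associator-natural : ∀ {X X′ Y Y′ Z Z′} {f : X ⇒ X′} {g : Y ⇒ Y′} {h : Z ⇒ Z′} →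
                         from associator ∘ ((f ⊗₁ g) ⊗₁ h) ≈ (f ⊗₁ (g ⊗₁ h)) ∘ from associator
    braiding-natural   : ∀ {X X′ Y Y′} {f : X ⇒ X′} {g : Y ⇒ Y′} →
                         braiding ∘ (f ⊗₁ g) ≈ (g ⊗₁ f) ∘ braiding

    triangle   : ∀ {X Y} → (id {X} ⊗₁ from (unitorˡ {Y})) ∘ from associator ≈ from unitorʳ ⊗₁ id
    pentagon   : ∀ {W X Y Z} →
                 (id {W} ⊗₁ from (associator {X} {Y} {Z})) ∘ from associator ∘ (from associator ⊗₁ id)
                   ≈ from associator ∘ from associator
    hexagon    : ∀ {X Y Z} →
                 (id {Y} ⊗₁ braiding {X} {Z}) ∘ from associator ∘ (braiding ⊗₁ id)
                   ≈ from associator ∘ braiding ∘ from associator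
    involutive : ∀ {X Y} → braiding {Y} {X} ∘ braiding {X} {Y} ≈ id

  _⊗ᵢ_ : ∀ {X X′ Y Y′} → X ≅ X′ → Y ≅ Y′ → X ⊗₀ Y ≅ X′ ⊗₀ Y′
  i ⊗ᵢ j = record
    { from = from i ⊗₁ from j
    ; to   = to i ⊗₁ to j
    ; isoˡ = inverse (isoˡ i) (isoˡ j)
    ; isoʳ = inverse (isoʳ i) (isoʳ j)
    }
    where
    inverse : ∀ {X X′ Y Y′} {f : X ⇒ X′} {f⁻¹ : X′ ⇒ X} {g : Y ⇒ Y′} {g⁻¹ : Y′ ⇒ Y} →
              f⁻¹ ∘ f ≈ id → g⁻¹ ∘ g ≈ id → (f⁻¹ ⊗₁ g⁻¹) ∘ (f ⊗₁ g) ≈ id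
    inverse p q = Equiv.trans (Equiv.sym ⊗-homomorphism) (Equiv.trans (⊗-resp-≈ p q) ⊗-identity)

  σ : ∀ {X Y} → X ⊗₀ Y ≅ Y ⊗₀ X
  σ = record { from = braiding ; to = braiding ; isoˡ = involutive ; isoʳ = involutive }

  -- Right-nested, with no trailing unit.
  ⨂ : List Obj → Obj
  ⨂ []           = I
  ⨂ (X ∷ [])     = X
  ⨂ (X ∷ Y ∷ Xs) = X ⊗₀ ⨂ (Y ∷ Xs)

  ⨂-cons : ∀ X Xs → X ⊗₀ ⨂ Xs ≅ ⨂ (X ∷ Xs)
  ⨂-cons X []       = unitorʳ
  ⨂-cons X (Y ∷ Xs) = idᵢ

record SymmetricMonoidalEndofunctor {o ℓ e : Level} (𝒞 : SymmetricMonoidalCategory o ℓ e) : Set (o ⊔ ℓ ⊔ e) where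
  open SymmetricMonoidalCategory 𝒞
  field
    F₀ : Obj → Obj
    F₁ : ∀ {X Y} → X ⇒ Y → F₀ X ⇒ F₀ Y
    identity     : ∀ {X} → F₁ (id {X}) ≈ id
    homomorphism : ∀ {X Y Z} {f : X ⇒ Y} {g : Y ⇒ Z} → F₁ (g ∘ f) ≈ F₁ g ∘ F₁ f
    F-resp-≈     : ∀ {X Y} {f g : X ⇒ Y} → f ≈ g → F₁ f ≈ F₁ g

    unit-iso : I ≅ F₀ I
    ⊗-iso    : ∀ {X Y} → F₀ X ⊗₀ F₀ Y ≅ F₀ (X ⊗₀ Y)

    ⊗-iso-natural : ∀ {X X′ Y Y′} {f : X ⇒ X′} {g : Y ⇒ Y′} →
                    from ⊗-iso ∘ (F₁ f ⊗₁ F₁ g) ≈ F₁ (f ⊗₁ g) ∘ from ⊗-iso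
    associativity : ∀ {X Y Z} →
                    F₁ (from associator) ∘ from (⊗-iso {X ⊗₀ Y} {Z}) ∘ (from ⊗-iso ⊗₁ id)
                      ≈ from ⊗-iso ∘ (id ⊗₁ from ⊗-iso) ∘ from associator
    unitaryˡ      : ∀ {X} → F₁ (from unitorˡ) ∘ from (⊗-iso {I} {X}) ∘ (from unit-iso ⊗₁ id) ≈ from unitorˡ
    unitaryʳ      : ∀ {X} → F₁ (from unitorʳ) ∘ from (⊗-iso {X} {I}) ∘ (id ⊗₁ from unit-iso) ≈ from unitorʳ
    symmetry      : ∀ {X Y} → F₁ (braiding {X} {Y}) ∘ from ⊗-iso ≈ from ⊗-iso ∘ braiding

  Fᵢ : ∀ {X Y} → X ≅ Y → F₀ X ≅ F₀ Y
  Fᵢ i = record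
    { from = F₁ (from i)
    ; to   = F₁ (to i)
    ; isoˡ = Equiv.trans (Equiv.sym homomorphism) (Equiv.trans (F-resp-≈ (isoˡ i)) identity)
    ; isoʳ = Equiv.trans (Equiv.sym homomorphism) (Equiv.trans (F-resp-≈ (isoʳ i)) identity)
    }

record Signature : Set₁ where
  field
    Qubit      : Set
    Gate       : Set
    qubits     : Gate → List Qubit
    distinct   : ∀ G → Unique (qubits G)
    duration   : Gate → ℝ
    duration≥0 : ∀ G → 0ℝ ≤ duration G

record Model (𝓢 : Signature) (o ℓ e : Level) : Set (lsuc (o ⊔ ℓ ⊔ e)) where
  open Signature 𝓢
  field
    𝒞 : SymmetricMonoidalCategory o ℓ e
  open SymmetricMonoidalCategory 𝒞 public
  field
    X : Qubit → Obj

  -- A strong monoidal functor from (ℝ, +, 0), as a discrete category, to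
  -- symmetric monoidal endofunctors of 𝒞 and monoidal natural transformations,
  -- with composition as tensor.  The discrete category has as its only morphisms
  -- the proofs of d ≈ᴿ d′, any two of which are equal; shift-≈ is the action of
  -- the functor on them.
  field
    Shift : ℝ → SymmetricMonoidalEndofunctor 𝒞
  module Shift d = SymmetricMonoidalEndofunctor (Shift d)
  open Shift using () renaming (F₀ to Shift₀; F₁ to Shift₁) public
  field
    shift-≈         : ∀ {d d′} → d ≈ᴿ d′ → ∀ {A} → Shift₀ d A ⇒ Shift₀ d′ A
    shift-≈-natural : ∀ {d d′} (p : d ≈ᴿ d′) {A B} {f : A ⇒ B} →
                      shift-≈ p ∘ Shift₁ d f ≈ Shift₁ d′ f ∘ shift-≈ p
    shift-≈-unit    : ∀ {d d′} (p : d ≈ᴿ d′) →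
                      shift-≈ p ∘ from (Shift.unit-iso d) ≈ from (Shift.unit-iso d′)
    shift-≈-⊗       : ∀ {d d′} (p : d ≈ᴿ d′) {A B} →
                      shift-≈ p ∘ from (Shift.⊗-iso d {A} {B})
                        ≈ from (Shift.⊗-iso d′) ∘ (shift-≈ p ⊗₁ shift-≈ p)
    shift-≈-id      : ∀ {d} (p : d ≈ᴿ d) {A} → shift-≈ p {A} ≈ id
    shift-≈-∘       : ∀ {d d′ d″} (p : d ≈ᴿ d′) (q : d′ ≈ᴿ d″) (r : d ≈ᴿ d″) {A} →
                      shift-≈ q {A} ∘ shift-≈ p ≈ shift-≈ r

    shift-0         : ∀ {A} → A ≅ Shift₀ 0ℝ A
    shift-0-natural : ∀ {A B} {f : A ⇒ B} → from shift-0 ∘ f ≈ Shift₁ 0ℝ f ∘ from shift-0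
    shift-0-unit    : from shift-0 ≈ from (Shift.unit-iso 0ℝ)
    shift-0-⊗       : ∀ {A B} → from shift-0 ≈ from (Shift.⊗-iso 0ℝ {A} {B}) ∘ (from shift-0 ⊗₁ from shift-0)

    shift-+         : ∀ d d′ {A} → Shift₀ d (Shift₀ d′ A) ≅ Shift₀ (d + d′) A
    shift-+-natural : ∀ d d′ {A B} {f : A ⇒ B} →
                      from (shift-+ d d′) ∘ Shift₁ d (Shift₁ d′ f) ≈ Shift₁ (d + d′) f ∘ from (shift-+ d d′)
    shift-+-unit    : ∀ d d′ →
                      from (shift-+ d d′) ∘ Shift₁ d (from (Shift.unit-iso d′)) ∘ from (Shift.unit-iso d)
                        ≈ from (Shift.unit-iso (d + d′))
    shift-+-⊗       : ∀ d d′ {A B} →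
                      from (shift-+ d d′) ∘ Shift₁ d (from (Shift.⊗-iso d′ {A} {B})) ∘ from (Shift.⊗-iso d)
                        ≈ from (Shift.⊗-iso (d + d′)) ∘ (from (shift-+ d d′) ⊗₁ from (shift-+ d d′))
    shift-+-≈       : ∀ {c c′ d d′} (p : c ≈ᴿ c′) (q : d ≈ᴿ d′) {A} →
                      from (shift-+ c′ d′ {A}) ∘ Shift₁ c′ (shift-≈ q) ∘ shift-≈ p
                        ≈ shift-≈ (+-cong p q) ∘ from (shift-+ c d)

    shift-assoc     : ∀ b c d {A} →
                      shift-≈ (+-assoc b c d) ∘ from (shift-+ (b + c) d {A}) ∘ from (shift-+ b c)
                        ≈ from (shift-+ b (c + d)) ∘ Shift₁ b (from (shift-+ c d))
    shift-identityˡ : ∀ d {A} → shift-≈ (+-identityˡ d) ∘ from (shift-+ 0ℝ d {A}) ∘ from shift-0 ≈ id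
    shift-identityʳ : ∀ d {A} → shift-≈ (+-identityʳ d) ∘ from (shift-+ d 0ℝ {A}) ∘ Shift₁ d (from shift-0) ≈ id

  field
    gate    : ∀ G → Shift₀ (- duration G) (⨂ (map X (qubits G))) ⇒ ⨂ (map X (qubits G))
    delay   : ∀ d q → Shift₀ (- d) (X q) ⇒ X q
    delay-≈ : ∀ {d d′} (p : d ≈ᴿ d′) q → delay d′ q ∘ shift-≈ (-‿cong p) ≈ delay d q

  shift-≈ᵢ : ∀ {d d′} → d ≈ᴿ d′ → ∀ {A} → Shift₀ d A ≅ Shift₀ d′ A
  shift-≈ᵢ p = record
    { from = shift-≈ p
    ; to   = shift-≈ (≈ᴿ-sym p)
    ; isoˡ = Equiv.trans (shift-≈-∘ p (≈ᴿ-sym p) ≈ᴿ-refl) (shift-≈-id ≈ᴿ-refl)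
    ; isoʳ = Equiv.trans (shift-≈-∘ (≈ᴿ-sym p) p ≈ᴿ-refl) (shift-≈-id ≈ᴿ-refl)
    }

module Language (Name : Set) (𝓢 : Signature) where
  open Signature 𝓢

  infixr 7 _`⊗_
  infix  6 _∶[_]_
  infix  4 _≃_ _≃ᵈ_ _≋_ _⊢_∶_ _⊢*_∶_ _⇝_ _⊸ₑ_

  data Ty : Set where
    `1   : Ty
    `q   : Qubit → Ty
    _`⊗_ : Ty → Ty → Ty
    □    : ℝ → Ty → Ty

  `⨂ : List Qubit → Ty
  `⨂ []            = `1
  `⨂ (q ∷ [])      = `q q
  `⨂ (q ∷ q′ ∷ qs) = `q q `⊗ `⨂ (q′ ∷ qs)

  -- x ∶[ d ] A is the declaration x :ᵈ A.
  record Decl : Set where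
    constructor _∶[_]_
    field
      name  : Name
      grade : ℝ
      type  : Ty

  Ctx : Set
  Ctx = List Decl

  _+ᵈ_ : ℝ → Decl → Decl
  d +ᵈ (x ∶[ e ] A) = x ∶[ d + e ] A

  _+ᶜ_ : ℝ → Ctx → Ctx
  d +ᶜ Γ = map (d +ᵈ_) Γ

  data Term : Set where
    var      : Name → Term
    ∗        : Term
    let-∗    : Term → Term → Term
    gate     : Gate → List Term → Term
    pair     : Term → Term → Term
    let-pair : Name → Name → Term → Term → Term
    box      : ℝ → Term → Term
    let-box  : ℝ → Name → Term → Term → Term
    delay    : ℝ → Term → Term
    let-var  : Name → Term → Term → Term

  -- Types and contexts that are the same once equal reals are identified.
  data _≃_ : Ty → Ty → Set where
    `1   : `1 ≃ `1
    `q   : ∀ q → `q q ≃ `q q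
    _`⊗_ : ∀ {A A′ B B′} → A ≃ A′ → B ≃ B′ → A `⊗ B ≃ A′ `⊗ B′
    □    : ∀ {d d′ A A′} → d ≈ᴿ d′ → A ≃ A′ → □ d A ≃ □ d′ A′

  data _≃ᵈ_ : Decl → Decl → Set where
    decl : ∀ {x d d′ A A′} → d ≈ᴿ d′ → A ≃ A′ → x ∶[ d ] A ≃ᵈ x ∶[ d′ ] A′

  _≋_ : Ctx → Ctx → Set
  _≋_ = Pointwise _≃ᵈ_

  ≃-refl : ∀ {A} → A ≃ A
  ≃-refl {`1}     = `1
  ≃-refl {`q q}   = `q q
  ≃-refl {A `⊗ B} = ≃-refl `⊗ ≃-refl
  ≃-refl {□ d A}  = □ ≈ᴿ-refl ≃-refl

  ≋-refl : ∀ {Γ} → Γ ≋ Γ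
  ≋-refl {[]}             = []
  ≋-refl {x ∶[ d ] A ∷ Γ} = decl ≈ᴿ-refl ≃-refl ∷ ≋-refl

  -- The rule conv has no informal counterpart: it makes the judgement invariant
  -- under replacing grades by equal reals.  In Γs ⊢* ts ∶ qs the three lists have
  -- the same length n, and Γᵢ ⊢ tᵢ ∶ qᵢ for each i.
  data _⊢_∶_ : Ctx → Term → Ty → Set
  data _⊢*_∶_ : List Ctx → List Term → List Qubit → Set

  data _⊢_∶_ where
    swap   : ∀ Γ {x y Δ t C} → Γ ++ x ∷ y ∷ Δ ⊢ t ∶ C → Γ ++ y ∷ x ∷ Δ ⊢ t ∶ C
    conv   : ∀ {Γ Γ′ t A A′} → Γ′ ≋ Γ → A ≃ A′ → Γ ⊢ t ∶ A → Γ′ ⊢ t ∶ A′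
    var    : ∀ x {A} → [ x ∶[ 0ℝ ] A ] ⊢ var x ∶ A
    unit-I : [] ⊢ ∗ ∶ `1
    unit-E : ∀ d {Γ Δ s t A} → Γ ⊢ s ∶ `1 → Δ ⊢ t ∶ A →
             (d +ᶜ Γ) ++ Δ ⊢ let-∗ s t ∶ A
    gate   : ∀ G {Γs ts} → Γs ⊢* ts ∶ qubits G →
             concat (map ((- duration G) +ᶜ_) Γs) ⊢ gate G ts ∶ `⨂ (qubits G)
    tens-I : ∀ {Γ Δ s t A B} → Γ ⊢ s ∶ A → Δ ⊢ t ∶ B → Γ ++ Δ ⊢ pair s t ∶ A `⊗ B
    tens-E : ∀ d x y {Γ Δ s t A B C} → Γ ⊢ s ∶ A `⊗ B →
             x ∶[ d ] A ∷ y ∶[ d ] B ∷ Δ ⊢ t ∶ C →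
             (d +ᶜ Γ) ++ Δ ⊢ let-pair x y s t ∶ C
    box-I  : ∀ d {Γ t A} → Γ ⊢ t ∶ A → d +ᶜ Γ ⊢ box d t ∶ □ d A
    box-E  : ∀ d e x {Γ Δ s t A B} → Γ ⊢ s ∶ □ d A → x ∶[ e ] A ∷ Δ ⊢ t ∶ B →
             ((e - d) +ᶜ Γ) ++ Δ ⊢ let-box d x s t ∶ B
    delay  : ∀ d {Γ t q} → 0ℝ ≤ d → Γ ⊢ t ∶ `q q → (- d) +ᶜ Γ ⊢ delay d t ∶ `q q
    let-E  : ∀ d x {Γ Δ s t A C} → Γ ⊢ s ∶ A → x ∶[ d ] A ∷ Δ ⊢ t ∶ C →
             (d +ᶜ Γ) ++ Δ ⊢ let-var x s t ∶ C

  data _⊢*_∶_ where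
    []  : [] ⊢* [] ∶ []
    _∷_ : ∀ {Γ Γs t ts q qs} → Γ ⊢ t ∶ `q q → Γs ⊢* ts ∶ qs → (Γ ∷ Γs) ⊢* (t ∷ ts) ∶ (q ∷ qs)

  -- A single application of the rule swap, read from premise to conclusion.
  data _⇝_ : Ctx → Ctx → Set where
    swap : ∀ Γ {x y Δ} → Γ ++ x ∷ y ∷ Δ ⇝ Γ ++ y ∷ x ∷ Δ

  under : ∀ z {Γ Γ′} → Γ ⇝ Γ′ → z ∷ Γ ⇝ z ∷ Γ′
  under z (swap Γ) = swap (z ∷ Γ)

  bring-front : ∀ Θ {x Ξ} → Star _⇝_ (Θ ++ x ∷ Ξ) (x ∷ Θ ++ Ξ)
  bring-front []      = done
  bring-front (y ∷ Θ) = gmap (y ∷_) (under y) (bring-front Θ) ◅◅ swap [] ◅ done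

  send-back : ∀ Θ {x Ξ} → Star _⇝_ (x ∷ Θ ++ Ξ) (Θ ++ x ∷ Ξ)
  send-back []      = done
  send-back (y ∷ Θ) = swap [] ◅ gmap (y ∷_) (under y) (send-back Θ)

  swaps : ∀ {Γ Γ′ t A} → Star _⇝_ Γ Γ′ → Γ ⊢ t ∶ A → Γ′ ⊢ t ∶ A
  swaps done          D = D
  swaps (swap Γ ◅ ss) D = swaps ss (swap Γ D)

  data _⊸ₑ_ : Ctx → Ctx → Set where
    unitₑ : ∀ x d → [ x ∶[ d ] `1 ] ⊸ₑ []
    tensₑ : ∀ x y z d A B → [ z ∶[ d ] A `⊗ B ] ⊸ₑ x ∶[ d ] A ∷ y ∶[ d ] B ∷ []
    boxₑ  : ∀ e′ x z d A → [ z ∶[ d ] □ e′ A ] ⊸ₑ [ x ∶[ d + e′ ] A ]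

  let-elim : ∀ {Γ Δ} → Γ ⊸ₑ Δ → Term → Term
  let-elim (unitₑ x d)           t = let-∗ (var x) t
  let-elim (tensₑ x y z d A B)   t = let-pair x y (var z) t
  let-elim (boxₑ e′ x z d A)     t = let-box e′ x (var z) t

  -- Swap Δ to the front, eliminate the variable bound in Γ, and swap Γ back.
  -- The eliminated variable has grade d + 0 or ((d + e′) - e′) + 0 in the
  -- conclusion of the elimination rule, which conv replaces by d.
  let-rule : ∀ {Γ Δ} Θ Ξ {t A} (e : Γ ⊸ₑ Δ) →
             Θ ++ Δ ++ Ξ ⊢ t ∶ A → Θ ++ Γ ++ Ξ ⊢ let-elim e t ∶ A
  let-rule Θ Ξ (unitₑ x d) D =
    swaps (send-back Θ)
      (conv (decl (≈ᴿ-sym (+-identityʳ d)) ≃-refl ∷ ≋-refl) ≃-refl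
        (unit-E d (var x) D))
  let-rule Θ Ξ (tensₑ x y z d A B) D =
    swaps (send-back Θ)
      (conv (decl (≈ᴿ-sym (+-identityʳ d)) ≃-refl ∷ ≋-refl) ≃-refl
        (tens-E d x y (var z)
          (swaps (bring-front Θ ◅◅ gmap (_ ∷_) (under _) (bring-front Θ)) D)))
  let-rule Θ Ξ (boxₑ e′ x z d A) D =
    swaps (send-back Θ)
      (conv (decl (≈ᴿ-sym (≈ᴿ-trans (+-identityʳ _) ([x+y]-y≈x d e′))) ≃-refl ∷ ≋-refl) ≃-refl
        (box-E e′ (d + e′) x (var z)
          (swaps (bring-front Θ) D)))

module Interpretation (Name : Set) (𝓢 : Signature) {o ℓ e : Level} (𝓜 : Model 𝓢 o ℓ e) where
  open Signature 𝓢
  open Language Name 𝓢 public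
  open Model 𝓜 public hiding (gate; delay)

  ⟦_⟧ᵗ : Ty → Obj
  ⟦ `1 ⟧ᵗ     = I
  ⟦ `q q ⟧ᵗ   = X q
  ⟦ A `⊗ B ⟧ᵗ = ⟦ A ⟧ᵗ ⊗₀ ⟦ B ⟧ᵗ
  ⟦ □ d A ⟧ᵗ  = Shift₀ d ⟦ A ⟧ᵗ

  ⟦_⟧ᶜ : Ctx → Obj
  ⟦ [] ⟧ᶜ             = I
  ⟦ x ∶[ d ] A ∷ Γ ⟧ᶜ = Shift₀ d ⟦ A ⟧ᵗ ⊗₀ ⟦ Γ ⟧ᶜ

  ⨂-≅ : ∀ qs → ⨂ (map X qs) ≅ ⟦ `⨂ qs ⟧ᵗ
  ⨂-≅ []            = idᵢ
  ⨂-≅ (q ∷ [])      = idᵢ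
  ⨂-≅ (q ∷ q′ ∷ qs) = idᵢ ⊗ᵢ ⨂-≅ (q′ ∷ qs)

  ++-≅ : ∀ Γ Δ → ⟦ Γ ++ Δ ⟧ᶜ ≅ ⟦ Γ ⟧ᶜ ⊗₀ ⟦ Δ ⟧ᶜ
  ++-≅ []               Δ = unitorˡ ⁻¹
  ++-≅ (x ∶[ d ] A ∷ Γ) Δ = associator ⁻¹ ∘ᵢ (idᵢ ⊗ᵢ ++-≅ Γ Δ)

  +ᶜ-≅ : ∀ d Γ → ⟦ d +ᶜ Γ ⟧ᶜ ≅ Shift₀ d ⟦ Γ ⟧ᶜ
  +ᶜ-≅ d []               = Shift.unit-iso d
  +ᶜ-≅ d (x ∶[ e ] A ∷ Γ) = Shift.⊗-iso d ∘ᵢ (shift-+ d e ⁻¹ ⊗ᵢ +ᶜ-≅ d Γ)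

  concat-+ᶜ-≅ : ∀ d Γs → ⟦ concat (map (d +ᶜ_) Γs) ⟧ᶜ ≅ Shift₀ d ⟦ concat Γs ⟧ᶜ
  concat-+ᶜ-≅ d []       = Shift.unit-iso d
  concat-+ᶜ-≅ d (Γ ∷ Γs) =
    Shift.Fᵢ d (++-≅ Γ (concat Γs) ⁻¹)
    ∘ᵢ Shift.⊗-iso d
    ∘ᵢ (+ᶜ-≅ d Γ ⊗ᵢ concat-+ᶜ-≅ d Γs)
    ∘ᵢ ++-≅ (d +ᶜ Γ) (concat (map (d +ᶜ_) Γs))

  swap-≅ : ∀ Γ {x y Δ} → ⟦ Γ ++ y ∷ x ∷ Δ ⟧ᶜ ≅ ⟦ Γ ++ x ∷ y ∷ Δ ⟧ᶜ
  swap-≅ []               = associator ∘ᵢ (σ ⊗ᵢ idᵢ) ∘ᵢ associator ⁻¹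
  swap-≅ (z ∶[ d ] A ∷ Γ) = idᵢ ⊗ᵢ swap-≅ Γ

  ≃-≅ : ∀ {A A′} → A ≃ A′ → ⟦ A ⟧ᵗ ≅ ⟦ A′ ⟧ᵗ
  ≃-≅ `1       = idᵢ
  ≃-≅ (`q q)   = idᵢ
  ≃-≅ (p `⊗ q) = ≃-≅ p ⊗ᵢ ≃-≅ q
  ≃-≅ (□ p q)  = shift-≈ᵢ p ∘ᵢ Shift.Fᵢ _ (≃-≅ q)

  ≋-≅ : ∀ {Γ Γ′} → Γ ≋ Γ′ → ⟦ Γ ⟧ᶜ ≅ ⟦ Γ′ ⟧ᶜ
  ≋-≅ []              = idᵢ
  ≋-≅ (decl p q ∷ ps) = (shift-≈ᵢ p ∘ᵢ Shift.Fᵢ _ (≃-≅ q)) ⊗ᵢ ≋-≅ ps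

  split-+ᶜ-≅ : ∀ d Γ Δ → ⟦ (d +ᶜ Γ) ++ Δ ⟧ᶜ ≅ Shift₀ d ⟦ Γ ⟧ᶜ ⊗₀ ⟦ Δ ⟧ᶜ
  split-+ᶜ-≅ d Γ Δ = (+ᶜ-≅ d Γ ⊗ᵢ idᵢ) ∘ᵢ ++-≅ (d +ᶜ Γ) Δ

  ⟦_⟧  : ∀ {Γ t A} → Γ ⊢ t ∶ A → ⟦ Γ ⟧ᶜ ⇒ ⟦ A ⟧ᵗ
  ⟦_⟧* : ∀ {Γs ts qs} → Γs ⊢* ts ∶ qs → ⟦ concat Γs ⟧ᶜ ⇒ ⨂ (map X qs)

  ⟦ swap Γ D ⟧ = ⟦ D ⟧ ∘ from (swap-≅ Γ)
  ⟦ conv p q D ⟧ = from (≃-≅ q) ∘ ⟦ D ⟧ ∘ from (≋-≅ p)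
  ⟦ var x ⟧ = to shift-0 ∘ from unitorʳ
  ⟦ unit-I ⟧ = id
  ⟦ unit-E d {Γ} {Δ} D E ⟧ =
    from unitorˡ ∘ (to (Shift.unit-iso d) ⊗₁ id) ∘ (Shift₁ d ⟦ D ⟧ ⊗₁ ⟦ E ⟧) ∘ from (split-+ᶜ-≅ d Γ Δ)
  ⟦ gate G {Γs} Ds ⟧ =
    from (⨂-≅ (qubits G)) ∘ Model.gate 𝓜 G ∘ Shift₁ (- duration G) ⟦ Ds ⟧* ∘ from (concat-+ᶜ-≅ (- duration G) Γs)
  ⟦ tens-I {Γ} {Δ} D E ⟧ = (⟦ D ⟧ ⊗₁ ⟦ E ⟧) ∘ from (++-≅ Γ Δ)
  ⟦ tens-E d x y {Γ} {Δ} D E ⟧ =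
    ⟦ E ⟧ ∘ from associator ∘ (to (Shift.⊗-iso d) ⊗₁ id) ∘ (Shift₁ d ⟦ D ⟧ ⊗₁ id) ∘ from (split-+ᶜ-≅ d Γ Δ)
  ⟦ box-I d {Γ} D ⟧ = Shift₁ d ⟦ D ⟧ ∘ from (+ᶜ-≅ d Γ)
  ⟦ box-E d e x {Γ} {Δ} D E ⟧ =
    ⟦ E ⟧
    ∘ ((shift-≈ ([x-y]+y≈x e d) ∘ from (shift-+ (e - d) d)) ⊗₁ id)
    ∘ (Shift₁ (e - d) ⟦ D ⟧ ⊗₁ id)
    ∘ from (split-+ᶜ-≅ (e - d) Γ Δ)
  ⟦ delay d {Γ} {q = q} _ D ⟧ = Model.delay 𝓜 d q ∘ Shift₁ (- d) ⟦ D ⟧ ∘ from (+ᶜ-≅ (- d) Γ)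
  ⟦ let-E d x {Γ} {Δ} D E ⟧ = ⟦ E ⟧ ∘ (Shift₁ d ⟦ D ⟧ ⊗₁ id) ∘ from (split-+ᶜ-≅ d Γ Δ)

  ⟦ [] ⟧* = id
  ⟦ _∷_ {Γ} {Γs} {q = q} {qs} D Ds ⟧* =
    from (⨂-cons (X q) (map X qs)) ∘ (⟦ D ⟧ ⊗₁ ⟦ Ds ⟧*) ∘ from (++-≅ Γ (concat Γs))

  -- The coherence isomorphism along which ⟦ Γ ⟧ᶜ and ⟦ Δ ⟧ᶜ are identified.
  elim-≅ : ∀ {Γ Δ} → Γ ⊸ₑ Δ → ⟦ Γ ⟧ᶜ ≅ ⟦ Δ ⟧ᶜ
  elim-≅ (unitₑ x d)         = unitorʳ ∘ᵢ (Shift.unit-iso d ⁻¹ ⊗ᵢ idᵢ)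
  elim-≅ (tensₑ x y z d A B) = associator ∘ᵢ (Shift.⊗-iso d ⁻¹ ⊗ᵢ idᵢ)
  elim-≅ (boxₑ e′ x z d A)   = shift-+ d e′ ⊗ᵢ idᵢ

  within-≅ : ∀ Θ {Γ Δ} Ξ → ⟦ Γ ⟧ᶜ ≅ ⟦ Δ ⟧ᶜ → ⟦ Θ ++ Γ ++ Ξ ⟧ᶜ ≅ ⟦ Θ ++ Δ ++ Ξ ⟧ᶜ
  within-≅ Θ {Γ} {Δ} Ξ i =
    (++-≅ Θ (Δ ++ Ξ) ⁻¹)
    ∘ᵢ (idᵢ ⊗ᵢ ((++-≅ Δ Ξ ⁻¹) ∘ᵢ (i ⊗ᵢ idᵢ) ∘ᵢ ++-≅ Γ Ξ))
    ∘ᵢ ++-≅ Θ (Γ ++ Ξ)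

{-# OPTIONS --safe #-}

-- Moving a declaration past Θ is a composite of the maps
-- s : X ⊗ (Y ⊗ R) → Y ⊗ (X ⊗ R).  By naturality, the hexagon and the unit
-- coherences, these commute with the coherence isomorphism of a normalised
-- eliminator, so by induction on Θ that isomorphism can be applied in place.
-- At the front of the context, the interpretation of the eliminated variable
-- cancels, by the right unit law of Shift, against the change of grade made
-- by conv.
module Submission where

open import Defs
open import Data.List using (_++_; []; _∷_; [_])
open import Data.List.Relation.Binary.Pointwise using (_∷_)
open import Level using (Level)
open import Relation.Binary.Bundles using (Setoid)
open import Relation.Binary.Construct.Closure.ReflexiveTransitive using (Star; _◅_; _◅◅_; gmap) renaming (ε to done)
import Relation.Binary.Reasoning.Setoid as SetoidReasoning

-- Equational reasoning with composites and isomorphisms in a category.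

module CategoryReasoning {o ℓ e : Level} (𝒞 : Category o ℓ e) where
  open Category 𝒞

  hom-setoid : ∀ {X Y} → Setoid ℓ e
  hom-setoid {X} {Y} = record { isEquivalence = equiv {X} {Y} }

  module HomReasoning {X Y} = SetoidReasoning (hom-setoid {X} {Y})

  infixr 4 refl⟩∘⟨_
  infixl 5 _⟩∘⟨refl

  refl⟩∘⟨_ : ∀ {X Y Z} {f : Y ⇒ Z} {g g′ : X ⇒ Y} → g ≈ g′ → f ∘ g ≈ f ∘ g′
  refl⟩∘⟨ p = ∘-resp-≈ Equiv.refl p

  _⟩∘⟨refl : ∀ {X Y Z} {f f′ : Y ⇒ Z} {g : X ⇒ Y} → f ≈ f′ → f ∘ g ≈ f′ ∘ g
  p ⟩∘⟨refl = ∘-resp-≈ p Equiv.refl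

  pullˡ : ∀ {W X Y Z} {f : Y ⇒ Z} {g : X ⇒ Y} {h : X ⇒ Z} {k : W ⇒ X} →
          f ∘ g ≈ h → f ∘ g ∘ k ≈ h ∘ k
  pullˡ p = Equiv.trans (Equiv.sym assoc) (p ⟩∘⟨refl)

  extendʳ : ∀ {W X Y Y′ Z} {f : Y ⇒ Z} {g : X ⇒ Y} {f′ : Y′ ⇒ Z} {g′ : X ⇒ Y′} {k : W ⇒ X} →
            f ∘ g ≈ f′ ∘ g′ → f ∘ g ∘ k ≈ f′ ∘ g′ ∘ k
  extendʳ p = Equiv.trans (pullˡ p) assoc

  cancelˡ : ∀ {X Y Z} {f : Y ⇒ Z} {g : Z ⇒ Y} {k : X ⇒ Z} → f ∘ g ≈ id → f ∘ g ∘ k ≈ k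
  cancelˡ p = Equiv.trans (pullˡ p) identityˡ

  cancelʳ : ∀ {X Y Z} {f : Y ⇒ X} {g : X ⇒ Y} {k : X ⇒ Z} → f ∘ g ≈ id → (k ∘ f) ∘ g ≈ k
  cancelʳ p = Equiv.trans assoc (Equiv.trans (refl⟩∘⟨ p) identityʳ)

  iso-epi : ∀ {X Y Z} (i : X ≅ Y) {f g : Y ⇒ Z} → f ∘ from i ≈ g ∘ from i → f ≈ g
  iso-epi i p = Equiv.trans (Equiv.sym (cancelʳ (isoʳ i)))
                  (Equiv.trans (p ⟩∘⟨refl) (cancelʳ (isoʳ i)))

  iso-mono : ∀ {X Y Z} (i : Y ≅ Z) {f g : X ⇒ Y} → from i ∘ f ≈ from i ∘ g → f ≈ g
  iso-mono i p = Equiv.trans (Equiv.sym (cancelˡ (isoˡ i)))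
                   (Equiv.trans (refl⟩∘⟨ p) (cancelˡ (isoˡ i)))

-- Whiskering and unit coherences in a symmetric monoidal category.

module SymmetricMonoidalCoherence {o ℓ e : Level} (𝒮 : SymmetricMonoidalCategory o ℓ e) where
  open SymmetricMonoidalCategory 𝒮
  open CategoryReasoning category public
  open HomReasoning

  id⊗-∘ : ∀ {W X Y Z} {f : Y ⇒ Z} {g : X ⇒ Y} → id {W} ⊗₁ (f ∘ g) ≈ (id ⊗₁ f) ∘ (id ⊗₁ g)
  id⊗-∘ = Equiv.trans (⊗-resp-≈ (Equiv.sym identityˡ) Equiv.refl) ⊗-homomorphism

  ⊗id-∘ : ∀ {W X Y Z} {f : Y ⇒ Z} {g : X ⇒ Y} → (f ∘ g) ⊗₁ id {W} ≈ (f ⊗₁ id) ∘ (g ⊗₁ id)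
  ⊗id-∘ = Equiv.trans (⊗-resp-≈ Equiv.refl (Equiv.sym identityˡ)) ⊗-homomorphism

  id⊗-resp : ∀ {W X Y} {f g : X ⇒ Y} → f ≈ g → id {W} ⊗₁ f ≈ id ⊗₁ g
  id⊗-resp = ⊗-resp-≈ Equiv.refl

  ⊗id-resp : ∀ {W X Y} {f g : X ⇒ Y} → f ≈ g → f ⊗₁ id {W} ≈ g ⊗₁ id
  ⊗id-resp p = ⊗-resp-≈ p Equiv.refl

  id⊗-⊗id-interchange : ∀ {X X′ Y Y′} {f : X ⇒ X′} {g : Y ⇒ Y′} →
                        (f ⊗₁ id) ∘ (id ⊗₁ g) ≈ (id ⊗₁ g) ∘ (f ⊗₁ id)
  id⊗-⊗id-interchange {f = f} {g} = begin
    (f ⊗₁ id) ∘ (id ⊗₁ g)   ≈⟨ ⊗-homomorphism ⟨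
    (f ∘ id) ⊗₁ (id ∘ g)    ≈⟨ ⊗-resp-≈ (Equiv.trans identityʳ (Equiv.sym identityˡ))
                                        (Equiv.trans identityˡ (Equiv.sym identityʳ)) ⟩
    (id ∘ f) ⊗₁ (g ∘ id)    ≈⟨ ⊗-homomorphism ⟩
    (id ⊗₁ g) ∘ (f ⊗₁ id)   ∎

  associator-natural-id⊗ : ∀ {W X Y Z} {f : Y ⇒ Z} →
                           from associator ∘ (id {W ⊗₀ X} ⊗₁ f) ≈ (id ⊗₁ (id ⊗₁ f)) ∘ from associator
  associator-natural-id⊗ =
    Equiv.trans (refl⟩∘⟨ ⊗-resp-≈ (Equiv.sym ⊗-identity) Equiv.refl) associator-natural

  associator-natural-⊗id : ∀ {W X Y Z} {f : Y ⇒ Z} →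
                           from associator ∘ ((f ⊗₁ id) ⊗₁ id) ≈ (f ⊗₁ id {W ⊗₀ X}) ∘ from associator
  associator-natural-⊗id =
    Equiv.trans associator-natural (⊗-resp-≈ Equiv.refl ⊗-identity ⟩∘⟨refl)

  -- By naturality, `unitorˡ` conjugates `id {I} ⊗₁ f` into `f`, so tensoring with `I` loses no
  -- information. Coherence equations may thus be checked after tensoring with `I`, where the
  -- pentagon and the hexagon apply.
  id⊗-faithful : ∀ {X Y} {f g : X ⇒ Y} → id {I} ⊗₁ f ≈ id ⊗₁ g → f ≈ g
  id⊗-faithful p = iso-epi unitorˡ
    (Equiv.trans (Equiv.sym unitorˡ-natural) (Equiv.trans (refl⟩∘⟨ p) unitorˡ-natural))

  ⊗id-faithful : ∀ {X Y} {f g : X ⇒ Y} → f ⊗₁ id {I} ≈ g ⊗₁ id → f ≈ g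
  ⊗id-faithful p = iso-epi unitorʳ
    (Equiv.trans (Equiv.sym unitorʳ-natural) (Equiv.trans (refl⟩∘⟨ p) unitorʳ-natural))

  -- Kelly's derivation of this unit law from the axioms: once the equation is tensored with `I` and
  -- precomposed with invertible associators, the pentagon and two uses of the triangle reduce it to
  -- naturality of the associator.
  unitorˡ-associator : ∀ {X Y} → from unitorˡ ∘ from (associator {I} {X} {Y}) ≈ from unitorˡ ⊗₁ id
  unitorˡ-associator {X} {Y} = id⊗-faithful (iso-epi (associator ∘ᵢ (associator ⊗ᵢ idᵢ)) (begin
    (id ⊗₁ (from unitorˡ ∘ from associator)) ∘ from associator ∘ (from associator ⊗₁ id)
      ≈⟨ id⊗-∘ ⟩∘⟨refl ⟩
    ((id ⊗₁ from unitorˡ) ∘ (id ⊗₁ from associator)) ∘ from associator ∘ (from associator ⊗₁ id)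
      ≈⟨ assoc ⟩
    (id ⊗₁ from unitorˡ) ∘ (id ⊗₁ from associator) ∘ from associator ∘ (from associator ⊗₁ id)
      ≈⟨ refl⟩∘⟨ pentagon ⟩
    (id ⊗₁ from unitorˡ) ∘ from associator ∘ from associator
      ≈⟨ pullˡ triangle ⟩
    (from unitorʳ ⊗₁ id) ∘ from associator
      ≈⟨ associator-natural-⊗id ⟨
    from associator ∘ ((from unitorʳ ⊗₁ id) ⊗₁ id)
      ≈⟨ refl⟩∘⟨ ⊗id-resp triangle ⟨
    from associator ∘ (((id ⊗₁ from unitorˡ) ∘ from associator) ⊗₁ id)
      ≈⟨ refl⟩∘⟨ ⊗id-∘ ⟩
    from associator ∘ ((id ⊗₁ from unitorˡ) ⊗₁ id) ∘ (from associator ⊗₁ id)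
      ≈⟨ extendʳ associator-natural ⟩
    (id ⊗₁ (from unitorˡ ⊗₁ id)) ∘ from associator ∘ (from associator ⊗₁ id) ∎))

  -- The hexagon at `X`, `I`, `I`, followed by `unitorˡ`, gives this equation tensored with `I` and
  -- postcomposed with an invertible braiding. Both decorations can be removed.
  unitorˡ-braiding : ∀ {X} → from unitorˡ ∘ braiding {X} {I} ≈ from unitorʳ
  unitorˡ-braiding {X} = ⊗id-faithful (iso-mono σ (begin
    braiding ∘ ((from unitorˡ ∘ braiding) ⊗₁ id)
      ≈⟨ refl⟩∘⟨ ⊗id-∘ ⟩
    braiding ∘ (from unitorˡ ⊗₁ id) ∘ (braiding ⊗₁ id)
      ≈⟨ refl⟩∘⟨ pullˡ unitorˡ-associator ⟨
    braiding ∘ from unitorˡ ∘ from associator ∘ (braiding ⊗₁ id)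
      ≈⟨ extendʳ unitorˡ-natural ⟨
    from unitorˡ ∘ (id ⊗₁ braiding) ∘ from associator ∘ (braiding ⊗₁ id)
      ≈⟨ refl⟩∘⟨ hexagon ⟩
    from unitorˡ ∘ from associator ∘ braiding ∘ from associator
      ≈⟨ pullˡ unitorˡ-associator ⟩
    (from unitorˡ ⊗₁ id) ∘ braiding ∘ from associator
      ≈⟨ extendʳ braiding-natural ⟨
    braiding ∘ (id ⊗₁ from unitorˡ) ∘ from associator
      ≈⟨ refl⟩∘⟨ triangle ⟩
    braiding ∘ (from unitorʳ ⊗₁ id) ∎))

  -- The last two factors form `++-≅` for a one-declaration context, which inserts the trailing unit
  -- of that context. By the triangle, `unitorʳ` deletes exactly this unit.
  unitorʳ⊗id-inverse : ∀ {X Y} →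
                       (from unitorʳ ⊗₁ id) ∘ to (associator {X} {I} {Y}) ∘ (id ⊗₁ to unitorˡ) ≈ id
  unitorʳ⊗id-inverse = begin
    (from unitorʳ ⊗₁ id) ∘ to associator ∘ (id ⊗₁ to unitorˡ)
      ≈⟨ triangle ⟩∘⟨refl ⟨
    ((id ⊗₁ from unitorˡ) ∘ from associator) ∘ to associator ∘ (id ⊗₁ to unitorˡ)
      ≈⟨ assoc ⟩
    (id ⊗₁ from unitorˡ) ∘ from associator ∘ to associator ∘ (id ⊗₁ to unitorˡ)
      ≈⟨ refl⟩∘⟨ cancelˡ (isoʳ associator) ⟩
    (id ⊗₁ from unitorˡ) ∘ (id ⊗₁ to unitorˡ)
      ≈⟨ isoʳ (idᵢ ⊗ᵢ unitorˡ) ⟩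
    id ∎

  -- The exchange `s` of adjacent factors, which is the map underlying `swap-≅ []`, and its
  -- coherence laws.

  s : ∀ {X Y R} → X ⊗₀ (Y ⊗₀ R) ⇒ Y ⊗₀ (X ⊗₀ R)
  s = from associator ∘ (braiding ⊗₁ id) ∘ to associator

  s∘associator : ∀ {X Y R} → s {X} {Y} {R} ∘ from associator ≈ from associator ∘ (braiding ⊗₁ id)
  s∘associator = Equiv.trans assoc (refl⟩∘⟨ cancelʳ (isoˡ associator))

  s-involutive : ∀ {X Y R} → s {Y} {X} {R} ∘ s {X} {Y} ≈ id
  s-involutive = begin
    s ∘ from associator ∘ (braiding ⊗₁ id) ∘ to associator   ≈⟨ extendʳ s∘associator ⟩
    from associator ∘ (braiding ⊗₁ id) ∘ (braiding ⊗₁ id) ∘ to associator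
      ≈⟨ refl⟩∘⟨ cancelˡ (isoʳ (σ ⊗ᵢ idᵢ)) ⟩
    from associator ∘ to associator                          ≈⟨ isoʳ associator ⟩
    id                                                       ∎

  s-natural : ∀ {X X′ Y Y′ R R′} {f : X ⇒ X′} {g : Y ⇒ Y′} {h : R ⇒ R′} →
              s ∘ (f ⊗₁ (g ⊗₁ h)) ≈ (g ⊗₁ (f ⊗₁ h)) ∘ s
  s-natural {f = f} {g} {h} = iso-epi associator (begin
    (s ∘ (f ⊗₁ (g ⊗₁ h))) ∘ from associator            ≈⟨ assoc ⟩
    s ∘ (f ⊗₁ (g ⊗₁ h)) ∘ from associator              ≈⟨ refl⟩∘⟨ associator-natural ⟨
    s ∘ from associator ∘ ((f ⊗₁ g) ⊗₁ h)              ≈⟨ extendʳ s∘associator ⟩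
    from associator ∘ (braiding ⊗₁ id) ∘ ((f ⊗₁ g) ⊗₁ h)
      ≈⟨ refl⟩∘⟨ ⊗-homomorphism ⟨
    from associator ∘ ((braiding ∘ (f ⊗₁ g)) ⊗₁ (id ∘ h))
      ≈⟨ refl⟩∘⟨ ⊗-resp-≈ braiding-natural (Equiv.trans identityˡ (Equiv.sym identityʳ)) ⟩
    from associator ∘ (((g ⊗₁ f) ∘ braiding) ⊗₁ (h ∘ id))
      ≈⟨ refl⟩∘⟨ ⊗-homomorphism ⟩
    from associator ∘ ((g ⊗₁ f) ⊗₁ h) ∘ (braiding ⊗₁ id)
      ≈⟨ extendʳ associator-natural ⟩
    (g ⊗₁ (f ⊗₁ h)) ∘ from associator ∘ (braiding ⊗₁ id)
      ≈⟨ refl⟩∘⟨ s∘associator ⟨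
    (g ⊗₁ (f ⊗₁ h)) ∘ s ∘ from associator              ≈⟨ assoc ⟨
    ((g ⊗₁ (f ⊗₁ h)) ∘ s) ∘ from associator            ∎)

  ⊗id-s : ∀ {W X X′ R} {f : X ⇒ X′} → (f ⊗₁ id) ∘ s {W} {X} {R} ≈ s ∘ (id ⊗₁ (f ⊗₁ id))
  ⊗id-s = Equiv.trans (⊗-resp-≈ Equiv.refl (Equiv.sym ⊗-identity) ⟩∘⟨refl) (Equiv.sym s-natural)

  -- `unitorˡ-braiding` and the triangle show that a unit may be deleted in place instead of being
  -- moved past `W` first. This is the inductive step for the unit eliminator.
  unitorˡ-s : ∀ {W R} → from unitorˡ ∘ s {W} {I} {R} ≈ id ⊗₁ from unitorˡ
  unitorˡ-s = iso-epi associator (begin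
    (from unitorˡ ∘ s) ∘ from associator                     ≈⟨ assoc ⟩
    from unitorˡ ∘ s ∘ from associator                       ≈⟨ refl⟩∘⟨ s∘associator ⟩
    from unitorˡ ∘ from associator ∘ (braiding ⊗₁ id)        ≈⟨ pullˡ unitorˡ-associator ⟩
    (from unitorˡ ⊗₁ id) ∘ (braiding ⊗₁ id)                  ≈⟨ ⊗id-∘ ⟨
    (from unitorˡ ∘ braiding) ⊗₁ id                          ≈⟨ ⊗id-resp unitorˡ-braiding ⟩
    from unitorʳ ⊗₁ id                                       ≈⟨ triangle ⟨
    (id ⊗₁ from unitorˡ) ∘ from associator                   ∎)

  -- This is the hexagon tensored with `R`, with pentagons supplying the rebracketing: a product
  -- moves past `W` by moving its two factors one after the other. It is the inductive step for the
  -- tensor eliminator.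
  associator-s : ∀ {W X Y R} →
                 from associator ∘ s {W} {X ⊗₀ Y} {R} ≈ (id ⊗₁ s) ∘ s ∘ (id ⊗₁ from associator)
  associator-s = iso-epi (associator ∘ᵢ (associator ⊗ᵢ idᵢ)) (begin
    (from associator ∘ s) ∘ from associator ∘ (from associator ⊗₁ id)
      ≈⟨ assoc ⟩
    from associator ∘ s ∘ from associator ∘ (from associator ⊗₁ id)
      ≈⟨ refl⟩∘⟨ extendʳ s∘associator ⟩
    from associator ∘ from associator ∘ (braiding ⊗₁ id) ∘ (from associator ⊗₁ id)
      -- The pentagon is read backwards to place an associator on each side of the braiding, so that
      -- the hexagon can be used under `⊗₁ id`.
      ≈⟨ extendʳ (Equiv.trans (Equiv.sym pentagon) (Equiv.sym assoc)) ⟩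
    ((id ⊗₁ from associator) ∘ from associator) ∘ (from associator ⊗₁ id) ∘ (braiding ⊗₁ id) ∘ (from associator ⊗₁ id)
      ≈⟨ refl⟩∘⟨ Equiv.trans (refl⟩∘⟨ Equiv.sym ⊗id-∘) (Equiv.sym ⊗id-∘) ⟩
    ((id ⊗₁ from associator) ∘ from associator) ∘ ((from associator ∘ braiding ∘ from associator) ⊗₁ id)
      ≈⟨ refl⟩∘⟨ ⊗id-resp hexagon ⟨
    ((id ⊗₁ from associator) ∘ from associator) ∘ (((id ⊗₁ braiding) ∘ from associator ∘ (braiding ⊗₁ id)) ⊗₁ id)
      ≈⟨ refl⟩∘⟨ Equiv.trans ⊗id-∘ (refl⟩∘⟨ ⊗id-∘) ⟩
    ((id ⊗₁ from associator) ∘ from associator) ∘ ((id ⊗₁ braiding) ⊗₁ id) ∘ (from associator ⊗₁ id) ∘ ((braiding ⊗₁ id) ⊗₁ id)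
      ≈⟨ assoc ⟩
    (id ⊗₁ from associator) ∘ from associator ∘ ((id ⊗₁ braiding) ⊗₁ id) ∘ (from associator ⊗₁ id) ∘ ((braiding ⊗₁ id) ⊗₁ id)
      ≈⟨ refl⟩∘⟨ extendʳ associator-natural ⟩
    (id ⊗₁ from associator) ∘ (id ⊗₁ (braiding ⊗₁ id)) ∘ from associator ∘ (from associator ⊗₁ id) ∘ ((braiding ⊗₁ id) ⊗₁ id)
      ≈⟨ extendʳ (Equiv.trans (Equiv.sym id⊗-∘) (Equiv.trans (id⊗-resp (Equiv.sym s∘associator)) id⊗-∘)) ⟩
    (id ⊗₁ s) ∘ (id ⊗₁ from associator) ∘ from associator ∘ (from associator ⊗₁ id) ∘ ((braiding ⊗₁ id) ⊗₁ id)
      ≈⟨ refl⟩∘⟨ Equiv.trans (refl⟩∘⟨ Equiv.sym assoc) (pullˡ pentagon) ⟩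
    (id ⊗₁ s) ∘ (from associator ∘ from associator) ∘ ((braiding ⊗₁ id) ⊗₁ id)
      ≈⟨ refl⟩∘⟨ Equiv.trans assoc (refl⟩∘⟨ associator-natural-⊗id) ⟩
    (id ⊗₁ s) ∘ from associator ∘ (braiding ⊗₁ id) ∘ from associator
      ≈⟨ refl⟩∘⟨ extendʳ s∘associator ⟨
    (id ⊗₁ s) ∘ s ∘ from associator ∘ from associator
      ≈⟨ refl⟩∘⟨ refl⟩∘⟨ pentagon ⟨
    (id ⊗₁ s) ∘ s ∘ (id ⊗₁ from associator) ∘ from associator ∘ (from associator ⊗₁ id)
      ≈⟨ Equiv.trans assoc (refl⟩∘⟨ assoc) ⟨
    ((id ⊗₁ s) ∘ s ∘ (id ⊗₁ from associator)) ∘ from associator ∘ (from associator ⊗₁ id) ∎)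

module LetElimination {o ℓ e : Level} (Name : Set) (𝓢 : Signature) (𝓜 : Model 𝓢 o ℓ e) where
  open Interpretation Name 𝓢 𝓜
  open SymmetricMonoidalCoherence 𝒞
  open HomReasoning

  -- Interpretation of sequences of swaps.

  ⟦_⟧ᵈ : Decl → Obj
  ⟦ x ∶[ d ] A ⟧ᵈ = Shift₀ d ⟦ A ⟧ᵗ

  -- The direction is reversed: swaps lead from premise to conclusion, while the interpretation of
  -- the conclusion first maps its context to that of the premise.
  ⟦_⟧ˢ : ∀ {Γ Γ′} → Star _⇝_ Γ Γ′ → ⟦ Γ′ ⟧ᶜ ⇒ ⟦ Γ ⟧ᶜ
  ⟦ done ⟧ˢ        = id
  ⟦ swap Γ ◅ ss ⟧ˢ = from (swap-≅ Γ) ∘ ⟦ ss ⟧ˢ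

  ⟦swaps⟧ : ∀ {Γ Γ′ t A} (ss : Star _⇝_ Γ Γ′) (D : Γ ⊢ t ∶ A) → ⟦ swaps ss D ⟧ ≈ ⟦ D ⟧ ∘ ⟦ ss ⟧ˢ
  ⟦swaps⟧ done          D = Equiv.sym identityʳ
  ⟦swaps⟧ (swap Γ ◅ ss) D = Equiv.trans (⟦swaps⟧ ss (swap Γ D)) assoc

  ⟦◅◅⟧ˢ : ∀ {Γ Γ′ Γ″} (ss : Star _⇝_ Γ Γ′) (ss′ : Star _⇝_ Γ′ Γ″) →
          ⟦ ss ◅◅ ss′ ⟧ˢ ≈ ⟦ ss ⟧ˢ ∘ ⟦ ss′ ⟧ˢ
  ⟦◅◅⟧ˢ done          ss′ = Equiv.sym identityˡ
  ⟦◅◅⟧ˢ (swap Γ ◅ ss) ss′ = Equiv.trans (refl⟩∘⟨ ⟦◅◅⟧ˢ ss ss′) (Equiv.sym assoc)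

  ⟦under⟧ˢ : ∀ z {Γ Γ′} (ss : Star _⇝_ Γ Γ′) → ⟦ gmap (z ∷_) (under z) ss ⟧ˢ ≈ id ⊗₁ ⟦ ss ⟧ˢ
  ⟦under⟧ˢ z done          = Equiv.sym ⊗-identity
  ⟦under⟧ˢ z (swap Γ ◅ ss) = Equiv.trans (refl⟩∘⟨ ⟦under⟧ˢ z ss) (Equiv.sym id⊗-∘)

  -- Because of the reversal in `⟦_⟧ˢ`, the morphism `front` carries the factor of `x` from the head
  -- to its place behind `Θ`, and `back` carries it to the head.
  front : ∀ Θ x Ξ → ⟦ x ∷ Θ ++ Ξ ⟧ᶜ ⇒ ⟦ Θ ++ x ∷ Ξ ⟧ᶜ
  front Θ x Ξ = ⟦ bring-front Θ {x} {Ξ} ⟧ˢ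

  back : ∀ Θ x Ξ → ⟦ Θ ++ x ∷ Ξ ⟧ᶜ ⇒ ⟦ x ∷ Θ ++ Ξ ⟧ᶜ
  back Θ x Ξ = ⟦ send-back Θ {x} {Ξ} ⟧ˢ

  front-∷ : ∀ w Θ x Ξ → front (w ∷ Θ) x Ξ ≈ (id ⊗₁ front Θ x Ξ) ∘ s
  front-∷ w Θ x Ξ =
    Equiv.trans (⟦◅◅⟧ˢ (gmap (w ∷_) (under w) (bring-front Θ)) _)
                (∘-resp-≈ (⟦under⟧ˢ w (bring-front Θ)) identityʳ)

  back-∷ : ∀ w Θ x Ξ → back (w ∷ Θ) x Ξ ≈ s ∘ (id ⊗₁ back Θ x Ξ)
  back-∷ w Θ x Ξ = refl⟩∘⟨ ⟦under⟧ˢ w (send-back Θ)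

  -- At each declaration of `Θ` the two exchanges meet in the middle as `s ∘ s` and cancel, because
  -- the braiding is a symmetry.
  front∘back : ∀ Θ x Ξ → front Θ x Ξ ∘ back Θ x Ξ ≈ id
  front∘back []      x Ξ = identityˡ
  front∘back (w ∷ Θ) x Ξ = begin
    front (w ∷ Θ) x Ξ ∘ back (w ∷ Θ) x Ξ                      ≈⟨ ∘-resp-≈ (front-∷ w Θ x Ξ) (back-∷ w Θ x Ξ) ⟩
    ((id ⊗₁ front Θ x Ξ) ∘ s) ∘ s ∘ (id ⊗₁ back Θ x Ξ)        ≈⟨ assoc ⟩
    (id ⊗₁ front Θ x Ξ) ∘ s ∘ s ∘ (id ⊗₁ back Θ x Ξ)          ≈⟨ refl⟩∘⟨ cancelˡ s-involutive ⟩
    (id ⊗₁ front Θ x Ξ) ∘ (id ⊗₁ back Θ x Ξ)                  ≈⟨ id⊗-∘ ⟨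
    id ⊗₁ (front Θ x Ξ ∘ back Θ x Ξ)                          ≈⟨ id⊗-resp (front∘back Θ x Ξ) ⟩
    id ⊗₁ id                                                  ≈⟨ ⊗-identity ⟩
    id                                                        ∎

  -- Maps acting behind a prefix `Θ`, and their passage to the head of the context.

  prefix : ∀ Θ {Γ Δ} → ⟦ Γ ⟧ᶜ ⇒ ⟦ Δ ⟧ᶜ → ⟦ Θ ++ Γ ⟧ᶜ ⇒ ⟦ Θ ++ Δ ⟧ᶜ
  prefix []      f = f
  prefix (w ∷ Θ) f = id ⊗₁ prefix Θ f

  prefix-resp-≈ : ∀ Θ {Γ Δ} {f g : ⟦ Γ ⟧ᶜ ⇒ ⟦ Δ ⟧ᶜ} → f ≈ g → prefix Θ {Γ} {Δ} f ≈ prefix Θ g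
  prefix-resp-≈ []      p = p
  prefix-resp-≈ (w ∷ Θ) p = id⊗-resp (prefix-resp-≈ Θ p)

  -- The associators and unitors in `++-≅` cancel by naturality. The form in `within-≅` is thereby
  -- replaced by the recursive `prefix`, which suits induction on `Θ`.
  prefix-++ : ∀ Θ {Γ Δ} (f : ⟦ Γ ⟧ᶜ ⇒ ⟦ Δ ⟧ᶜ) →
              to (++-≅ Θ Δ) ∘ (id ⊗₁ f) ∘ from (++-≅ Θ Γ) ≈ prefix Θ f
  prefix-++ [] f = begin
    from unitorˡ ∘ (id ⊗₁ f) ∘ to unitorˡ   ≈⟨ extendʳ unitorˡ-natural ⟩
    f ∘ from unitorˡ ∘ to unitorˡ           ≈⟨ refl⟩∘⟨ isoʳ unitorˡ ⟩
    f ∘ id                                  ≈⟨ identityʳ ⟩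
    f                                       ∎
  prefix-++ (w ∷ Θ) {Γ} {Δ} f = begin
    ((id ⊗₁ to (++-≅ Θ Δ)) ∘ from associator) ∘ (id ⊗₁ f) ∘ to associator ∘ (id ⊗₁ from (++-≅ Θ Γ))
      ≈⟨ assoc ⟩
    (id ⊗₁ to (++-≅ Θ Δ)) ∘ from associator ∘ (id ⊗₁ f) ∘ to associator ∘ (id ⊗₁ from (++-≅ Θ Γ))
      ≈⟨ refl⟩∘⟨ extendʳ associator-natural-id⊗ ⟩
    (id ⊗₁ to (++-≅ Θ Δ)) ∘ (id ⊗₁ (id ⊗₁ f)) ∘ from associator ∘ to associator ∘ (id ⊗₁ from (++-≅ Θ Γ))
      ≈⟨ refl⟩∘⟨ refl⟩∘⟨ cancelˡ (isoʳ associator) ⟩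
    (id ⊗₁ to (++-≅ Θ Δ)) ∘ (id ⊗₁ (id ⊗₁ f)) ∘ (id ⊗₁ from (++-≅ Θ Γ))
      ≈⟨ Equiv.trans id⊗-∘ (refl⟩∘⟨ id⊗-∘) ⟨
    id ⊗₁ (to (++-≅ Θ Δ) ∘ (id ⊗₁ f) ∘ from (++-≅ Θ Γ))
      ≈⟨ id⊗-resp (prefix-++ Θ f) ⟩
    id ⊗₁ prefix Θ f ∎

  -- The exchange `s` is natural, so `h` slides past the declarations of `Θ` one at a time. This
  -- serves the box eliminator, which replaces one declaration by one.
  back-natural : ∀ Θ z x Ξ (h : ⟦ z ⟧ᵈ ⇒ ⟦ x ⟧ᵈ) →
                 (h ⊗₁ id) ∘ back Θ z Ξ ≈ back Θ x Ξ ∘ prefix Θ {z ∷ Ξ} {x ∷ Ξ} (h ⊗₁ id)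
  back-natural []      z x Ξ h = Equiv.trans identityʳ (Equiv.sym identityˡ)
  back-natural (w ∷ Θ) z x Ξ h = begin
    (h ⊗₁ id) ∘ back (w ∷ Θ) z Ξ                   ≈⟨ refl⟩∘⟨ back-∷ w Θ z Ξ ⟩
    (h ⊗₁ id) ∘ s ∘ (id ⊗₁ back Θ z Ξ)             ≈⟨ extendʳ ⊗id-s ⟩
    s ∘ (id ⊗₁ (h ⊗₁ id)) ∘ (id ⊗₁ back Θ z Ξ)     ≈⟨ refl⟩∘⟨ id⊗-∘ ⟨
    s ∘ (id ⊗₁ ((h ⊗₁ id) ∘ back Θ z Ξ))           ≈⟨ refl⟩∘⟨ id⊗-resp (back-natural Θ z x Ξ h) ⟩
    s ∘ (id ⊗₁ (back Θ x Ξ ∘ P))                   ≈⟨ refl⟩∘⟨ id⊗-∘ ⟩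
    s ∘ (id ⊗₁ back Θ x Ξ) ∘ (id ⊗₁ P)             ≈⟨ pullˡ (Equiv.sym (back-∷ w Θ x Ξ)) ⟩
    back (w ∷ Θ) x Ξ ∘ (id ⊗₁ P)                   ∎
    where P = prefix Θ {z ∷ Ξ} {x ∷ Ξ} (h ⊗₁ id)

  back-unit : ∀ Θ z Ξ (h : ⟦ z ⟧ᵈ ⇒ I) →
              from unitorˡ ∘ (h ⊗₁ id) ∘ back Θ z Ξ ≈ prefix Θ {z ∷ Ξ} {Ξ} (from unitorˡ ∘ (h ⊗₁ id))
  back-unit []      z Ξ h = refl⟩∘⟨ identityʳ
  back-unit (w ∷ Θ) z Ξ h = begin
    from unitorˡ ∘ (h ⊗₁ id) ∘ back (w ∷ Θ) z Ξ
      ≈⟨ refl⟩∘⟨ refl⟩∘⟨ back-∷ w Θ z Ξ ⟩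
    from unitorˡ ∘ (h ⊗₁ id) ∘ s ∘ (id ⊗₁ back Θ z Ξ)
      ≈⟨ refl⟩∘⟨ extendʳ ⊗id-s ⟩
    from unitorˡ ∘ s ∘ (id ⊗₁ (h ⊗₁ id)) ∘ (id ⊗₁ back Θ z Ξ)
      ≈⟨ pullˡ unitorˡ-s ⟩
    (id ⊗₁ from unitorˡ) ∘ (id ⊗₁ (h ⊗₁ id)) ∘ (id ⊗₁ back Θ z Ξ)
      ≈⟨ Equiv.trans id⊗-∘ (refl⟩∘⟨ id⊗-∘) ⟨
    id ⊗₁ (from unitorˡ ∘ (h ⊗₁ id) ∘ back Θ z Ξ)
      ≈⟨ id⊗-resp (back-unit Θ z Ξ h) ⟩
    id ⊗₁ prefix Θ (from unitorˡ ∘ (h ⊗₁ id)) ∎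

  -- By `associator-s`, bringing a tensor product to the head and then splitting it amounts to
  -- splitting it in place and bringing out first `x`, then `y`.
  back-tensor : ∀ Θ z x y Ξ (h : ⟦ z ⟧ᵈ ⇒ ⟦ x ⟧ᵈ ⊗₀ ⟦ y ⟧ᵈ) →
                from associator ∘ (h ⊗₁ id) ∘ back Θ z Ξ
                  ≈ (id ⊗₁ back Θ y Ξ) ∘ back Θ x (y ∷ Ξ)
                    ∘ prefix Θ {z ∷ Ξ} {x ∷ y ∷ Ξ} (from associator ∘ (h ⊗₁ id))
  back-tensor []      z x y Ξ h =
    Equiv.trans (refl⟩∘⟨ identityʳ)
                (Equiv.sym (Equiv.trans (⊗-identity ⟩∘⟨refl) (Equiv.trans identityˡ identityˡ)))
  back-tensor (w ∷ Θ) z x y Ξ h = begin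
    from associator ∘ (h ⊗₁ id) ∘ back (w ∷ Θ) z Ξ
      ≈⟨ refl⟩∘⟨ refl⟩∘⟨ back-∷ w Θ z Ξ ⟩
    from associator ∘ (h ⊗₁ id) ∘ s ∘ (id ⊗₁ back Θ z Ξ)
      ≈⟨ refl⟩∘⟨ extendʳ ⊗id-s ⟩
    from associator ∘ s ∘ (id ⊗₁ (h ⊗₁ id)) ∘ (id ⊗₁ back Θ z Ξ)
      ≈⟨ Equiv.trans (pullˡ associator-s) (Equiv.trans assoc (refl⟩∘⟨ assoc)) ⟩
    (id ⊗₁ s) ∘ s ∘ (id ⊗₁ from associator) ∘ (id ⊗₁ (h ⊗₁ id)) ∘ (id ⊗₁ back Θ z Ξ)
      ≈⟨ refl⟩∘⟨ refl⟩∘⟨ Equiv.trans id⊗-∘ (refl⟩∘⟨ id⊗-∘) ⟨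
    (id ⊗₁ s) ∘ s ∘ (id ⊗₁ (from associator ∘ (h ⊗₁ id) ∘ back Θ z Ξ))
      ≈⟨ refl⟩∘⟨ refl⟩∘⟨ id⊗-resp (back-tensor Θ z x y Ξ h) ⟩
    (id ⊗₁ s) ∘ s ∘ (id ⊗₁ ((id ⊗₁ back Θ y Ξ) ∘ back Θ x (y ∷ Ξ) ∘ P))
      ≈⟨ refl⟩∘⟨ refl⟩∘⟨ Equiv.trans id⊗-∘ (refl⟩∘⟨ id⊗-∘) ⟩
    (id ⊗₁ s) ∘ s ∘ (id ⊗₁ (id ⊗₁ back Θ y Ξ)) ∘ (id ⊗₁ back Θ x (y ∷ Ξ)) ∘ (id ⊗₁ P)
      -- Here `back Θ y Ξ` acts only on the factor behind the two that `s` exchanges, so naturality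
      -- lets them pass. Each `s` then joins the `back` that it extends to `w ∷ Θ`.
      ≈⟨ refl⟩∘⟨ extendʳ s-natural ⟩
    (id ⊗₁ s) ∘ (id ⊗₁ (id ⊗₁ back Θ y Ξ)) ∘ s ∘ (id ⊗₁ back Θ x (y ∷ Ξ)) ∘ (id ⊗₁ P)
      ≈⟨ pullˡ (Equiv.sym id⊗-∘) ⟩
    (id ⊗₁ (s ∘ (id ⊗₁ back Θ y Ξ))) ∘ s ∘ (id ⊗₁ back Θ x (y ∷ Ξ)) ∘ (id ⊗₁ P)
      ≈⟨ ∘-resp-≈ (id⊗-resp (Equiv.sym (back-∷ w Θ y Ξ)))
                  (pullˡ (Equiv.sym (back-∷ w Θ x (y ∷ Ξ)))) ⟩
    (id ⊗₁ back (w ∷ Θ) y Ξ) ∘ back (w ∷ Θ) x (y ∷ Ξ) ∘ (id ⊗₁ P) ∎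
    where P = prefix Θ {z ∷ Ξ} {x ∷ y ∷ Ξ} (from associator ∘ (h ⊗₁ id))

  -- Grade changes made by `conv`, and the interpretation of the eliminated variable.

  shift-≈∘Shift₁-id : ∀ {d d′} (p : d ≈ᴿ d′) {A} {f : A ⇒ A} → f ≈ id →
                      shift-≈ p ∘ Shift₁ d f ≈ shift-≈ p
  shift-≈∘Shift₁-id p f≈id =
    Equiv.trans (refl⟩∘⟨ Equiv.trans (Shift.F-resp-≈ _ f≈id) (Shift.identity _)) identityʳ

  ≃-≅-refl : ∀ A → from (≃-≅ (≃-refl {A})) ≈ id
  ≃-≅-refl `1       = Equiv.refl
  ≃-≅-refl (`q q)   = Equiv.refl
  ≃-≅-refl (A `⊗ B) = Equiv.trans (⊗-resp-≈ (≃-≅-refl A) (≃-≅-refl B)) ⊗-identity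
  ≃-≅-refl (□ d A)  = Equiv.trans (shift-≈∘Shift₁-id ≈ᴿ-refl (≃-≅-refl A)) (shift-≈-id ≈ᴿ-refl)

  ≋-≅-refl : ∀ Γ → from (≋-≅ (≋-refl {Γ})) ≈ id
  ≋-≅-refl []               = Equiv.refl
  ≋-≅-refl (x ∶[ d ] A ∷ Γ) =
    Equiv.trans (⊗-resp-≈ (Equiv.trans (shift-≈∘Shift₁-id ≈ᴿ-refl (≃-≅-refl A)) (shift-≈-id ≈ᴿ-refl))
                          (≋-≅-refl Γ))
                ⊗-identity

  -- Reflexivity witnesses are interpreted by identities, so only the change of grade of the first
  -- declaration survives.
  ⟦conv⟧-head : ∀ {x d d′ B Γ t A} (p : d′ ≈ᴿ d) (D : x ∶[ d ] B ∷ Γ ⊢ t ∶ A) →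
                ⟦ conv (decl p ≃-refl ∷ ≋-refl) ≃-refl D ⟧ ≈ ⟦ D ⟧ ∘ (shift-≈ p ⊗₁ id)
  ⟦conv⟧-head {B = B} {Γ} {A = A} p D =
    Equiv.trans (≃-≅-refl A ⟩∘⟨refl)
    (Equiv.trans identityˡ
      (refl⟩∘⟨ ⊗-resp-≈ (shift-≈∘Shift₁-id p (≃-≅-refl B)) (≋-≅-refl Γ)))

  -- The unit law of the monoidal functor `Shift d` handles the trailing unit of the context. The
  -- right unit law of `Shift` itself turns what remains into a change of grade from `d + 0ℝ` to
  -- `d`.
  Shift₁-var : ∀ d x A →
               Shift₁ d ⟦ var x {A} ⟧ ∘ from (+ᶜ-≅ d [ x ∶[ 0ℝ ] A ]) ≈ shift-≈ (+-identityʳ d) ∘ from unitorʳ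
  Shift₁-var d x A = begin
    Shift₁ d (to shift-0 ∘ from unitorʳ) ∘ μ ∘ (π⁻¹ ⊗₁ η)
      ≈⟨ Shift.homomorphism d ⟩∘⟨refl ⟩
    (Shift₁ d (to shift-0) ∘ Shift₁ d (from unitorʳ)) ∘ μ ∘ (π⁻¹ ⊗₁ η)
      ≈⟨ assoc ⟩
    Shift₁ d (to shift-0) ∘ Shift₁ d (from unitorʳ) ∘ μ ∘ (π⁻¹ ⊗₁ η)
      -- Splitting `π⁻¹ ⊗₁ η` isolates `id ⊗₁ η`, the form that `unitaryʳ` requires.
      ≈⟨ refl⟩∘⟨ refl⟩∘⟨ refl⟩∘⟨ Equiv.trans (⊗-resp-≈ (Equiv.sym identityˡ) (Equiv.sym identityʳ)) ⊗-homomorphism ⟩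
    Shift₁ d (to shift-0) ∘ Shift₁ d (from unitorʳ) ∘ μ ∘ (id ⊗₁ η) ∘ (π⁻¹ ⊗₁ id)
      ≈⟨ refl⟩∘⟨ Equiv.trans (refl⟩∘⟨ Equiv.sym assoc) (pullˡ (Shift.unitaryʳ d)) ⟩
    Shift₁ d (to shift-0) ∘ from unitorʳ ∘ (π⁻¹ ⊗₁ id)
      ≈⟨ refl⟩∘⟨ unitorʳ-natural ⟩
    Shift₁ d (to shift-0) ∘ π⁻¹ ∘ from unitorʳ
      ≈⟨ pullˡ (Equiv.sym right-unit) ⟩
    shift-≈ (+-identityʳ d) ∘ from unitorʳ ∎
    where
    μ   = from (Shift.⊗-iso d)
    η   = from (Shift.unit-iso d)
    π⁻¹ = to (shift-+ d 0ℝ {⟦ A ⟧ᵗ})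
    i   = shift-+ d 0ℝ ∘ᵢ Shift.Fᵢ d (shift-0 {⟦ A ⟧ᵗ})
    right-unit : shift-≈ (+-identityʳ d) ≈ to i
    -- Both sides are left inverses of the isomorphism `i`, hence equal.
    right-unit = iso-epi i (Equiv.trans (shift-identityʳ d) (Equiv.sym (isoˡ i)))

  split-var : ∀ d x A Δ →
              (Shift₁ d ⟦ var x {A} ⟧ ⊗₁ id) ∘ from (split-+ᶜ-≅ d [ x ∶[ 0ℝ ] A ] Δ)
                ≈ shift-≈ (+-identityʳ d) ⊗₁ id
  split-var d x A Δ = begin
    (Shift₁ d ⟦ var x {A} ⟧ ⊗₁ id) ∘ (from (+ᶜ-≅ d [ x ∶[ 0ℝ ] A ]) ⊗₁ id) ∘ to associator ∘ (id ⊗₁ to unitorˡ)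
      ≈⟨ pullˡ (Equiv.trans (Equiv.sym ⊗id-∘) (Equiv.trans (⊗id-resp (Shift₁-var d x A)) ⊗id-∘)) ⟩
    ((shift-≈ (+-identityʳ d) ⊗₁ id) ∘ (from unitorʳ ⊗₁ id)) ∘ to associator ∘ (id ⊗₁ to unitorˡ)
      ≈⟨ assoc ⟩
    (shift-≈ (+-identityʳ d) ⊗₁ id) ∘ (from unitorʳ ⊗₁ id) ∘ to associator ∘ (id ⊗₁ to unitorˡ)
      ≈⟨ refl⟩∘⟨ unitorʳ⊗id-inverse ⟩
    (shift-≈ (+-identityʳ d) ⊗₁ id) ∘ id
      ≈⟨ identityʳ ⟩
    shift-≈ (+-identityʳ d) ⊗₁ id ∎

  -- Composites of grade changes depend only on their endpoints, so the one from the variable and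
  -- the one from `conv` merge into the action of any proof `q`.
  split-var-conv : ∀ {c} d x A Δ (p : c ≈ᴿ d + 0ℝ) (q : c ≈ᴿ d) →
                   ((Shift₁ d ⟦ var x {A} ⟧ ⊗₁ id) ∘ from (split-+ᶜ-≅ d [ x ∶[ 0ℝ ] A ] Δ)) ∘ (shift-≈ p ⊗₁ id)
                     ≈ shift-≈ q ⊗₁ id
  split-var-conv d x A Δ p q =
    Equiv.trans (split-var d x A Δ ⟩∘⟨refl)
    (Equiv.trans (Equiv.sym ⊗id-∘) (⊗id-resp (shift-≈-∘ p (+-identityʳ d) q)))

  split-var-conv-id : ∀ d x A Δ (p : d ≈ᴿ d + 0ℝ) →
                      ((Shift₁ d ⟦ var x {A} ⟧ ⊗₁ id) ∘ from (split-+ᶜ-≅ d [ x ∶[ 0ℝ ] A ] Δ)) ∘ (shift-≈ p ⊗₁ id)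
                        ≈ id
  split-var-conv-id d x A Δ p =
    Equiv.trans (split-var-conv d x A Δ p ≈ᴿ-refl)
    (Equiv.trans (⊗id-resp (shift-≈-id ≈ᴿ-refl)) ⊗-identity)

  -- `box-E` at grade `d + e` passes through the grade `(d + e) - e`. Naturality of `shift-+` in its
  -- grades moves `p` to the other side, where it meets an opposite change of grade and cancels.
  shift-+-conv : ∀ d e {A} (p : d ≈ᴿ (d + e) - e) →
                 (shift-≈ ([x-y]+y≈x (d + e) e) ∘ from (shift-+ ((d + e) - e) e {A})) ∘ shift-≈ p
                   ≈ from (shift-+ d e)
  shift-+-conv d e p = begin
    (shift-≈ r ∘ from (shift-+ ((d + e) - e) e)) ∘ shift-≈ p
      ≈⟨ assoc ⟩
    shift-≈ r ∘ from (shift-+ ((d + e) - e) e) ∘ shift-≈ p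
      -- A trivial change of the inner grade is inserted to match the shape of `shift-+-≈`.
      ≈⟨ refl⟩∘⟨ refl⟩∘⟨ Equiv.trans (Equiv.trans (Shift.F-resp-≈ _ (shift-≈-id ≈ᴿ-refl)) (Shift.identity _) ⟩∘⟨refl) identityˡ ⟨
    shift-≈ r ∘ from (shift-+ ((d + e) - e) e) ∘ Shift₁ ((d + e) - e) (shift-≈ ≈ᴿ-refl) ∘ shift-≈ p
      ≈⟨ refl⟩∘⟨ shift-+-≈ p ≈ᴿ-refl ⟩
    shift-≈ r ∘ shift-≈ (+-cong p ≈ᴿ-refl) ∘ from (shift-+ d e)
      ≈⟨ cancelˡ (Equiv.trans (shift-≈-∘ _ _ ≈ᴿ-refl) (shift-≈-id ≈ᴿ-refl)) ⟩
    from (shift-+ d e) ∎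
    where r = [x-y]+y≈x (d + e) e

  -- The coherence isomorphism of an eliminator at the head of the context.

  at-front : ∀ {Γ Δ} → Γ ⊸ₑ Δ → ∀ Ξ → ⟦ Γ ++ Ξ ⟧ᶜ ⇒ ⟦ Δ ++ Ξ ⟧ᶜ
  at-front (unitₑ x d)         Ξ = from unitorˡ ∘ (to (Shift.unit-iso d) ⊗₁ id)
  at-front (tensₑ x y z d A B) Ξ = from associator ∘ (to (Shift.⊗-iso d) ⊗₁ id)
  at-front (boxₑ e′ x z d A)   Ξ = from (shift-+ d e′) ⊗₁ id

  -- `elim-≅` relates contexts ending in a unit factor, and `++-≅` creates and removes these units
  -- around it. After cancellation there remains the map that the elimination rule itself produces.
  at-front-++ : ∀ {Γ Δ} (ϵ : Γ ⊸ₑ Δ) Ξ →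
                to (++-≅ Δ Ξ) ∘ (from (elim-≅ ϵ) ⊗₁ id) ∘ from (++-≅ Γ Ξ) ≈ at-front ϵ Ξ
  at-front-++ (unitₑ x d) Ξ = begin
    from unitorˡ ∘ ((from unitorʳ ∘ (η⁻¹ ⊗₁ id)) ⊗₁ id) ∘ to associator ∘ (id ⊗₁ to unitorˡ)
      ≈⟨ refl⟩∘⟨ Equiv.trans (⊗id-resp unitorʳ-natural) ⊗id-∘ ⟩∘⟨refl ⟩
    from unitorˡ ∘ ((η⁻¹ ⊗₁ id) ∘ (from unitorʳ ⊗₁ id)) ∘ to associator ∘ (id ⊗₁ to unitorˡ)
      ≈⟨ refl⟩∘⟨ Equiv.trans assoc (refl⟩∘⟨ unitorʳ⊗id-inverse) ⟩
    from unitorˡ ∘ (η⁻¹ ⊗₁ id) ∘ id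
      ≈⟨ refl⟩∘⟨ identityʳ ⟩
    from unitorˡ ∘ (η⁻¹ ⊗₁ id) ∎
    where η⁻¹ = to (Shift.unit-iso d)
  at-front-++ (tensₑ x y z d A B) Ξ = begin
    ((id ⊗₁ ((id ⊗₁ from unitorˡ) ∘ from associator)) ∘ from associator)
      ∘ ((from associator ∘ (μ⁻¹ ⊗₁ id)) ⊗₁ id) ∘ R
      ≈⟨ ∘-resp-≈ (Equiv.trans (id⊗-∘ ⟩∘⟨refl) assoc) (Equiv.trans (⊗id-∘ ⟩∘⟨refl) assoc) ⟩
    ((id ⊗₁ (id ⊗₁ from unitorˡ)) ∘ (id ⊗₁ from associator) ∘ from associator)
      ∘ (from associator ⊗₁ id) ∘ ((μ⁻¹ ⊗₁ id) ⊗₁ id) ∘ R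
      -- Of the three associators in the pentagon, two come from `++-≅` on the two-declaration
      -- context and one from `elim-≅`.
      ≈⟨ pullˡ (Equiv.trans assoc (refl⟩∘⟨ Equiv.trans assoc pentagon)) ⟩
    ((id ⊗₁ (id ⊗₁ from unitorˡ)) ∘ from associator ∘ from associator) ∘ ((μ⁻¹ ⊗₁ id) ⊗₁ id) ∘ R
      ≈⟨ Equiv.trans (extendʳ (Equiv.sym associator-natural-id⊗)) (Equiv.sym assoc) ⟩∘⟨refl ⟩
    ((from associator ∘ (id ⊗₁ from unitorˡ)) ∘ from associator) ∘ ((μ⁻¹ ⊗₁ id) ⊗₁ id) ∘ R
      ≈⟨ Equiv.trans assoc (refl⟩∘⟨ extendʳ associator-natural-⊗id) ⟩
    (from associator ∘ (id ⊗₁ from unitorˡ)) ∘ (μ⁻¹ ⊗₁ id) ∘ from associator ∘ R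
      ≈⟨ refl⟩∘⟨ refl⟩∘⟨ cancelˡ (isoʳ associator) ⟩
    (from associator ∘ (id ⊗₁ from unitorˡ)) ∘ (μ⁻¹ ⊗₁ id) ∘ (id ⊗₁ to unitorˡ)
      ≈⟨ Equiv.trans (refl⟩∘⟨ id⊗-⊗id-interchange) assoc ⟩
    from associator ∘ (id ⊗₁ from unitorˡ) ∘ (id ⊗₁ to unitorˡ) ∘ (μ⁻¹ ⊗₁ id)
      ≈⟨ refl⟩∘⟨ cancelˡ (isoʳ (idᵢ ⊗ᵢ unitorˡ)) ⟩
    from associator ∘ (μ⁻¹ ⊗₁ id) ∎
    where
    μ⁻¹ = to (Shift.⊗-iso d)
    R   = to associator ∘ (id ⊗₁ to unitorˡ)
  at-front-++ (boxₑ e′ x z d A) Ξ = begin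
    ((id ⊗₁ from unitorˡ) ∘ from associator) ∘ ((π ⊗₁ id) ⊗₁ id) ∘ to associator ∘ (id ⊗₁ to unitorˡ)
      ≈⟨ Equiv.trans assoc (refl⟩∘⟨ extendʳ associator-natural-⊗id) ⟩
    (id ⊗₁ from unitorˡ) ∘ (π ⊗₁ id) ∘ from associator ∘ to associator ∘ (id ⊗₁ to unitorˡ)
      ≈⟨ refl⟩∘⟨ refl⟩∘⟨ cancelˡ (isoʳ associator) ⟩
    (id ⊗₁ from unitorˡ) ∘ (π ⊗₁ id) ∘ (id ⊗₁ to unitorˡ)
      ≈⟨ refl⟩∘⟨ id⊗-⊗id-interchange ⟩
    (id ⊗₁ from unitorˡ) ∘ (id ⊗₁ to unitorˡ) ∘ (π ⊗₁ id)
      ≈⟨ cancelˡ (isoʳ (idᵢ ⊗ᵢ unitorˡ)) ⟩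
    π ⊗₁ id ∎
    where π = from (shift-+ d e′)

  within-≈-prefix : ∀ {Γ Δ} (ϵ : Γ ⊸ₑ Δ) Θ Ξ →
                    from (within-≅ Θ Ξ (elim-≅ ϵ)) ≈ prefix Θ {Γ ++ Ξ} {Δ ++ Ξ} (at-front ϵ Ξ)
  within-≈-prefix {Γ} {Δ} ϵ Θ Ξ =
    Equiv.trans (prefix-++ Θ _) (prefix-resp-≈ Θ {Γ ++ Ξ} {Δ ++ Ξ} (at-front-++ ϵ Ξ))

  -- The elimination rules applied to a variable, first at the head of the context and then in
  -- place.

  ⟦unit-E⟧-var : ∀ x d {Δ t A} (p : d ≈ᴿ d + 0ℝ) (D : Δ ⊢ t ∶ A) →
                 ⟦ unit-E d (var x) D ⟧ ∘ (shift-≈ p ⊗₁ id) ≈ ⟦ D ⟧ ∘ at-front (unitₑ x d) Δ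
  ⟦unit-E⟧-var x d {Δ} p D = begin
    (from unitorˡ ∘ (η⁻¹ ⊗₁ id) ∘ (V ⊗₁ ⟦ D ⟧) ∘ S) ∘ (shift-≈ p ⊗₁ id)
      ≈⟨ Equiv.trans assoc (refl⟩∘⟨ assoc) ⟩
    from unitorˡ ∘ (η⁻¹ ⊗₁ id) ∘ ((V ⊗₁ ⟦ D ⟧) ∘ S) ∘ (shift-≈ p ⊗₁ id)
      -- In `unit-E` both premises act at once. Factoring the tensor puts `V` next to `S`, where the
      -- variable cancels.
      ≈⟨ refl⟩∘⟨ refl⟩∘⟨ Equiv.trans (split-V⊗D ⟩∘⟨refl) assoc ⟩∘⟨refl ⟩
    from unitorˡ ∘ (η⁻¹ ⊗₁ id) ∘ ((id ⊗₁ ⟦ D ⟧) ∘ (V ⊗₁ id) ∘ S) ∘ (shift-≈ p ⊗₁ id)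
      ≈⟨ refl⟩∘⟨ refl⟩∘⟨ assoc ⟩
    from unitorˡ ∘ (η⁻¹ ⊗₁ id) ∘ (id ⊗₁ ⟦ D ⟧) ∘ ((V ⊗₁ id) ∘ S) ∘ (shift-≈ p ⊗₁ id)
      ≈⟨ refl⟩∘⟨ refl⟩∘⟨ Equiv.trans (refl⟩∘⟨ split-var-conv-id d x `1 Δ p) identityʳ ⟩
    from unitorˡ ∘ (η⁻¹ ⊗₁ id) ∘ (id ⊗₁ ⟦ D ⟧)
      ≈⟨ refl⟩∘⟨ id⊗-⊗id-interchange ⟩
    from unitorˡ ∘ (id ⊗₁ ⟦ D ⟧) ∘ (η⁻¹ ⊗₁ id)
      ≈⟨ extendʳ unitorˡ-natural ⟩
    ⟦ D ⟧ ∘ from unitorˡ ∘ (η⁻¹ ⊗₁ id) ∎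
    where
    η⁻¹ = to (Shift.unit-iso d)
    V   = Shift₁ d ⟦ var x {`1} ⟧
    S   = from (split-+ᶜ-≅ d [ x ∶[ 0ℝ ] `1 ] Δ)
    split-V⊗D : V ⊗₁ ⟦ D ⟧ ≈ (id ⊗₁ ⟦ D ⟧) ∘ (V ⊗₁ id)
    split-V⊗D = Equiv.trans (⊗-resp-≈ (Equiv.sym identityˡ) (Equiv.sym identityʳ)) ⊗-homomorphism

  ⟦tens-E⟧-var : ∀ x y z d A B {Δ t C} (p : d ≈ᴿ d + 0ℝ) (D : x ∶[ d ] A ∷ y ∶[ d ] B ∷ Δ ⊢ t ∶ C) →
                 ⟦ tens-E d x y (var z) D ⟧ ∘ (shift-≈ p ⊗₁ id) ≈ ⟦ D ⟧ ∘ at-front (tensₑ x y z d A B) Δ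
  ⟦tens-E⟧-var x y z d A B {Δ} p D = begin
    (⟦ D ⟧ ∘ from associator ∘ (μ⁻¹ ⊗₁ id) ∘ VS) ∘ (shift-≈ p ⊗₁ id)
      ≈⟨ Equiv.trans assoc (refl⟩∘⟨ Equiv.trans assoc (refl⟩∘⟨ assoc)) ⟩
    ⟦ D ⟧ ∘ from associator ∘ (μ⁻¹ ⊗₁ id) ∘ VS ∘ (shift-≈ p ⊗₁ id)
      ≈⟨ refl⟩∘⟨ refl⟩∘⟨ Equiv.trans (refl⟩∘⟨ split-var-conv-id d z (A `⊗ B) Δ p) identityʳ ⟩
    ⟦ D ⟧ ∘ from associator ∘ (μ⁻¹ ⊗₁ id) ∎
    where
    μ⁻¹ = to (Shift.⊗-iso d)
    VS  = (Shift₁ d ⟦ var z {A `⊗ B} ⟧ ⊗₁ id) ∘ from (split-+ᶜ-≅ d [ z ∶[ 0ℝ ] A `⊗ B ] Δ)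

  ⟦box-E⟧-var : ∀ e′ x z d A {Δ t B} (p : d ≈ᴿ ((d + e′) - e′) + 0ℝ) (D : x ∶[ d + e′ ] A ∷ Δ ⊢ t ∶ B) →
                ⟦ box-E e′ (d + e′) x (var z) D ⟧ ∘ (shift-≈ p ⊗₁ id) ≈ ⟦ D ⟧ ∘ at-front (boxₑ e′ x z d A) Δ
  ⟦box-E⟧-var e′ x z d A {Δ} p D = begin
    (⟦ D ⟧ ∘ (κ ⊗₁ id) ∘ VS) ∘ (shift-≈ p ⊗₁ id)
      ≈⟨ Equiv.trans assoc (refl⟩∘⟨ assoc) ⟩
    ⟦ D ⟧ ∘ (κ ⊗₁ id) ∘ VS ∘ (shift-≈ p ⊗₁ id)
      -- The variable accounts only for the summand `0ℝ`. A change of grade from `d` to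
      -- `(d + e′) - e′` is left over and is absorbed into `κ`.
      ≈⟨ refl⟩∘⟨ refl⟩∘⟨ split-var-conv c z (□ e′ A) Δ p q ⟩
    ⟦ D ⟧ ∘ (κ ⊗₁ id) ∘ (shift-≈ q ⊗₁ id)
      ≈⟨ refl⟩∘⟨ Equiv.trans (Equiv.sym ⊗id-∘) (⊗id-resp (shift-+-conv d e′ q)) ⟩
    ⟦ D ⟧ ∘ (from (shift-+ d e′) ⊗₁ id) ∎
    where
    c  = (d + e′) - e′
    q  = ≈ᴿ-sym ([x+y]-y≈x d e′)
    κ  = shift-≈ ([x-y]+y≈x (d + e′) e′) ∘ from (shift-+ c e′)
    VS = (Shift₁ c ⟦ var z {□ e′ A} ⟧ ⊗₁ id) ∘ from (split-+ᶜ-≅ c [ z ∶[ 0ℝ ] □ e′ A ] Δ)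

  -- The swaps of `send-back` contribute a `back`, past which the eliminator is moved to act behind
  -- `Θ`. Any `back` still left cancels against the `front` coming from the swaps applied to the
  -- premise.
  ⟦let-rule⟧ : ∀ {Γ Δ} (ϵ : Γ ⊸ₑ Δ) Θ Ξ {t A} (D : Θ ++ Δ ++ Ξ ⊢ t ∶ A) →
               ⟦ let-rule Θ Ξ ϵ D ⟧ ≈ ⟦ D ⟧ ∘ prefix Θ {Γ ++ Ξ} {Δ ++ Ξ} (at-front ϵ Ξ)
  ⟦let-rule⟧ (unitₑ x d) Θ Ξ D = begin
    ⟦ let-rule Θ Ξ (unitₑ x d) D ⟧
      ≈⟨ ⟦swaps⟧ (send-back Θ) _ ⟩
    ⟦ conv (decl p ≃-refl ∷ ≋-refl) ≃-refl (unit-E d (var x) D) ⟧ ∘ β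
      ≈⟨ Equiv.trans (⟦conv⟧-head p (unit-E d (var x) D)) (⟦unit-E⟧-var x d p D) ⟩∘⟨refl ⟩
    (⟦ D ⟧ ∘ from unitorˡ ∘ (η⁻¹ ⊗₁ id)) ∘ β
      ≈⟨ Equiv.trans assoc (refl⟩∘⟨ assoc) ⟩
    ⟦ D ⟧ ∘ from unitorˡ ∘ (η⁻¹ ⊗₁ id) ∘ β
      ≈⟨ refl⟩∘⟨ back-unit Θ (x ∶[ d ] `1) Ξ η⁻¹ ⟩
    ⟦ D ⟧ ∘ prefix Θ (from unitorˡ ∘ (η⁻¹ ⊗₁ id)) ∎
    where
    p   = ≈ᴿ-sym (+-identityʳ d)
    η⁻¹ = to (Shift.unit-iso d)
    β   = back Θ (x ∶[ d ] `1) Ξ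
  ⟦let-rule⟧ (tensₑ x y z d A B) Θ Ξ D = begin
    ⟦ let-rule Θ Ξ (tensₑ x y z d A B) D ⟧
      ≈⟨ ⟦swaps⟧ (send-back Θ) _ ⟩
    ⟦ conv (decl p ≃-refl ∷ ≋-refl) ≃-refl (tens-E d x y (var z) D′) ⟧ ∘ β
      ≈⟨ Equiv.trans (⟦conv⟧-head p (tens-E d x y (var z) D′)) (⟦tens-E⟧-var x y z d A B p D′) ⟩∘⟨refl ⟩
    (⟦ D′ ⟧ ∘ from associator ∘ (μ⁻¹ ⊗₁ id)) ∘ β
      ≈⟨ Equiv.trans assoc (refl⟩∘⟨ assoc) ⟩
    ⟦ D′ ⟧ ∘ from associator ∘ (μ⁻¹ ⊗₁ id) ∘ β
      ≈⟨ ∘-resp-≈ (⟦swaps⟧ ss D) (back-tensor Θ (z ∶[ d ] A `⊗ B) x′ y′ Ξ μ⁻¹) ⟩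
    (⟦ D ⟧ ∘ ⟦ ss ⟧ˢ) ∘ (id ⊗₁ back Θ y′ Ξ) ∘ back Θ x′ (y′ ∷ Ξ) ∘ P
      ≈⟨ Equiv.trans assoc (refl⟩∘⟨ ⟦ss⟧ ⟩∘⟨refl) ⟩
    ⟦ D ⟧ ∘ (front Θ x′ (y′ ∷ Ξ) ∘ (id ⊗₁ front Θ y′ Ξ)) ∘ (id ⊗₁ back Θ y′ Ξ) ∘ back Θ x′ (y′ ∷ Ξ) ∘ P
      -- The moves are nested: the pair for `y` cancels inside, which makes the pair for `x`
      -- adjacent.
      ≈⟨ refl⟩∘⟨ Equiv.trans assoc (refl⟩∘⟨ cancelˡ cancel-y) ⟩
    ⟦ D ⟧ ∘ front Θ x′ (y′ ∷ Ξ) ∘ back Θ x′ (y′ ∷ Ξ) ∘ P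
      ≈⟨ refl⟩∘⟨ cancelˡ (front∘back Θ x′ (y′ ∷ Ξ)) ⟩
    ⟦ D ⟧ ∘ P ∎
    where
    x′  = x ∶[ d ] A
    y′  = y ∶[ d ] B
    p   = ≈ᴿ-sym (+-identityʳ d)
    μ⁻¹ = to (Shift.⊗-iso d)
    β   = back Θ (z ∶[ d ] A `⊗ B) Ξ
    P   = prefix Θ {z ∶[ d ] A `⊗ B ∷ Ξ} {x′ ∷ y′ ∷ Ξ} (from associator ∘ (μ⁻¹ ⊗₁ id))
    ss  = bring-front Θ ◅◅ gmap (x′ ∷_) (under x′) (bring-front Θ)
    D′  = swaps ss D
    ⟦ss⟧ : ⟦ ss ⟧ˢ ≈ front Θ x′ (y′ ∷ Ξ) ∘ (id ⊗₁ front Θ y′ Ξ)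
    ⟦ss⟧ = Equiv.trans (⟦◅◅⟧ˢ (bring-front Θ) _) (refl⟩∘⟨ ⟦under⟧ˢ x′ (bring-front Θ))
    cancel-y : (id ⊗₁ front Θ y′ Ξ) ∘ (id ⊗₁ back Θ y′ Ξ) ≈ id
    cancel-y = Equiv.trans (Equiv.sym id⊗-∘) (Equiv.trans (id⊗-resp (front∘back Θ y′ Ξ)) ⊗-identity)
  ⟦let-rule⟧ (boxₑ e′ x z d A) Θ Ξ D = begin
    ⟦ let-rule Θ Ξ (boxₑ e′ x z d A) D ⟧
      ≈⟨ ⟦swaps⟧ (send-back Θ) _ ⟩
    ⟦ conv (decl p ≃-refl ∷ ≋-refl) ≃-refl (box-E e′ (d + e′) x (var z) D′) ⟧ ∘ β
      ≈⟨ Equiv.trans (⟦conv⟧-head p (box-E e′ (d + e′) x (var z) D′)) (⟦box-E⟧-var e′ x z d A p D′) ⟩∘⟨refl ⟩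
    (⟦ D′ ⟧ ∘ (π ⊗₁ id)) ∘ β
      ≈⟨ assoc ⟩
    ⟦ D′ ⟧ ∘ (π ⊗₁ id) ∘ β
      ≈⟨ ∘-resp-≈ (⟦swaps⟧ (bring-front Θ) D) (back-natural Θ (z ∶[ d ] □ e′ A) x′ Ξ π) ⟩
    (⟦ D ⟧ ∘ front Θ x′ Ξ) ∘ back Θ x′ Ξ ∘ P
      ≈⟨ Equiv.trans assoc (refl⟩∘⟨ cancelˡ (front∘back Θ x′ Ξ)) ⟩
    ⟦ D ⟧ ∘ P ∎
    where
    x′ = x ∶[ d + e′ ] A
    p  = ≈ᴿ-sym (≈ᴿ-trans (+-identityʳ _) ([x+y]-y≈x d e′))
    π  = from (shift-+ d e′)
    β  = back Θ (z ∶[ d ] □ e′ A) Ξ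
    P  = prefix Θ {z ∶[ d ] □ e′ A ∷ Ξ} {x′ ∷ Ξ} (π ⊗₁ id)
    D′ = swaps (bring-front Θ) D

lemma20 : ∀ {o ℓ e : Level} (Name : Set) (𝓢 : Signature) (𝓜 : Model 𝓢 o ℓ e) →
    let open Interpretation Name 𝓢 𝓜 in
    ∀ {Γ Δ} (ϵ : Γ ⊸ₑ Δ) Θ Ξ {t A} (D : Θ ++ Δ ++ Ξ ⊢ t ∶ A) →
    ⟦ let-rule Θ Ξ ϵ D ⟧ ≈ ⟦ D ⟧ ∘ from (within-≅ Θ Ξ (elim-≅ ϵ))
lemma20 Name 𝓢 𝓜 ϵ Θ Ξ D =
  Equiv.trans (⟦let-rule⟧ ϵ Θ Ξ D) (refl⟩∘⟨ Equiv.sym (within-≈-prefix ϵ Θ Ξ))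
  where
  open Interpretation Name 𝓢 𝓜
  open LetElimination Name 𝓢 𝓜
  open SymmetricMonoidalCoherence 𝒞
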